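{- Let $(\Phi_i)_{i\in\mathbb{Z}}$ be a family of reduced indefinite binary quadratic forms over $\mathbb{Q}((1/T))$ of the same discriminant $D$, written $\Phi_i=((-1)^iA_i,\,B_i,\,(-1)^{i+1}A_{i+1})$, such that for every $i$ the form $\Phi_{i+1}$ is obtained from $\Phi_i$ by a transformation $\begin{pmatrix}0&1\\-1&\delta_i\end{pmatrix}$ with $\delta_i\in\mathbb{Q}[T]$. Let $Q$ be a binary quadratic form properly equivalent to $\Phi_0$. Then $$m(Q)=\inf_{i\in\mathbb{Z}}\deg A_i.$$
   Context: $\mathbb{Q}((1/T))$ is the field of formal Laurent series in $1/T$ over $\mathbb{Q}$; $\deg$ of a nonzero series is the exponent of its leading term, $\deg0=-\infty$. A binary quadratic form $(A,B,C)$ is $AX^2+BXY+CY^2$ with $A,B,C\in\mathbb{Q}((1/T))$ not all in $\mathbb{Q}(T)$, discriminant $D=B^2-4AC$; indefinite means $D\ne0$ is a square in $\mathbb{Q}((1/T))$; a square root $\sqrt D$ is fixed for the discriminant $D$. If $A\ne0$, first root $f=\frac{\sqrt D-B}{2A}$, second root $s=\frac{ -\sqrt D-B}{2A}$. Reduced means $A\ne0$, $f\ne0$, $\deg f<0<\deg s$. A matrix $\begin{pmatrix}\alpha&\beta\\\gamma&\delta\end{pmatrix}$ over $\mathbb{Q}[T]$ transforms $q(x,y)$ into $q(\alpha X+\beta Y,\gamma X+\delta Y)$; two forms are properly equivalent if one is transformed into the other by such a matrix of determinant $1$. $m(Q)=\inf\{\deg Q(X,Y):X,Y\in\mathbb{Q}[T],\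 (X,Y)\ne(0,0)\}$. -}

module Defs where

open import Level using (0ℓ)
open import Data.Nat.Base as ℕ using (ℕ; zero; suc; parity)
import Data.Nat.Properties as ℕₚ
open import Data.Parity.Base using (0ℙ; 1ℙ)
open import Data.Fin.Base using (toℕ)
open import Data.Integer.Base as ℤ using (ℤ; +_; +0; +[1+_]; -[1+_]; ∣_∣; 0ℤ; 1ℤ)
import Data.Integer.Properties as ℤₚ
open import Data.Rational.Base as ℚ using (ℚ; 0ℚ; 1ℚ)
import Data.Rational.Properties as ℚₚ
open import Algebra.Properties.CommutativeMonoid.Sum ℚₚ.+-0-commutativeMonoid
  using (sum-syntax; sum-cong-≗; sum-replicate-zero)
open import Data.Product.Base using (∃; ∃-syntax; _×_; _,_)
open import Data.Empty using (⊥-elim)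
open import Relation.Nullary.Negation.Core using (¬_)
open import Relation.Unary using (Pred; _∈_)
open import Relation.Nullary.Construct.Add.Infimum public using (_₋; ⊥₋; [_])
open import Relation.Binary.Construct.Add.Infimum.NonStrict ℤ._≤_ public
  using (_≤₋_; ⊥₋≤_; [_]; ≤₋-trans)
open import Relation.Binary.Construct.Add.Infimum.Strict ℤ._<_ public
  using (_<₋_; ⊥₋<[_]; [_])
open import Relation.Binary.PropositionalEquality.Core
  using (_≡_; refl; cong; cong₂; sym; trans; subst)

infix  4 _≈_
infixl 6 _+_ _-_
infixl 7 _*_
infix  8 -_

-- Formal Laurent series in 1/T: coeff n is the coefficient of Tⁿ, and only
-- finitely many positive powers of T occur.  The bound is not part of the
-- value of the series, so equality is _≈_ below.

record ℚ⟨⟨1/T⟩⟩ : Set where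
  field
    coeff    : ℤ → ℚ
    bound    : ℤ
    vanishes : ∀ n → bound ℤ.< n → coeff n ≡ 0ℚ

open ℚ⟨⟨1/T⟩⟩ public

_≈_ : ℚ⟨⟨1/T⟩⟩ → ℚ⟨⟨1/T⟩⟩ → Set
x ≈ y = ∀ n → coeff x n ≡ coeff y n

const : ℚ → ℚ⟨⟨1/T⟩⟩
const q .coeff +0       = q
const q .coeff +[1+ _ ] = 0ℚ
const q .coeff -[1+ _ ] = 0ℚ
const q .bound          = 0ℤ
const q .vanishes +[1+ _ ] _ = refl
const q .vanishes +0 (ℤ.+<+ ())

0# 1# 2# 4# : ℚ⟨⟨1/T⟩⟩
0# = const 0ℚ
1# = const 1ℚ
2# = const ((+ 2) ℚ./ 1)
4# = const ((+ 4) ℚ./ 1)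

_+_ : ℚ⟨⟨1/T⟩⟩ → ℚ⟨⟨1/T⟩⟩ → ℚ⟨⟨1/T⟩⟩
(x + y) .coeff n = coeff x n ℚ.+ coeff y n
(x + y) .bound   = bound x ℤ.⊔ bound y
(x + y) .vanishes n b<n = cong₂ ℚ._+_
  (vanishes x n (ℤₚ.≤-<-trans (ℤₚ.i≤i⊔j (bound x) (bound y)) b<n))
  (vanishes y n (ℤₚ.≤-<-trans (ℤₚ.i≤j⊔i (bound x) (bound y)) b<n))

-_ : ℚ⟨⟨1/T⟩⟩ → ℚ⟨⟨1/T⟩⟩
(- x) .coeff n        = ℚ.- coeff x n
(- x) .bound          = bound x
(- x) .vanishes n b<n = cong ℚ.-_ (vanishes x n b<n)

_-_ : ℚ⟨⟨1/T⟩⟩ → ℚ⟨⟨1/T⟩⟩ → ℚ⟨⟨1/T⟩⟩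
x - y = x + (- y)

-- The Cauchy product.  With i = bound x - k and j = n - i, the product
-- xᵢ yⱼ can be nonzero only for 0 ≤ k ≤ bound x + bound y - n; taking the
-- absolute value of the upper limit adds only terms with j > bound y.

cauchyTerm : (x y : ℚ⟨⟨1/T⟩⟩) (n : ℤ) (k : ℕ) → ℚ
cauchyTerm x y n k = coeff x i ℚ.* coeff y (n ℤ.- i)
  where i = bound x ℤ.- + k

cauchyLength : (x y : ℚ⟨⟨1/T⟩⟩) (n : ℤ) → ℕ
cauchyLength x y n = suc ∣ bound x ℤ.+ bound y ℤ.- n ∣

_*_ : ℚ⟨⟨1/T⟩⟩ → ℚ⟨⟨1/T⟩⟩ → ℚ⟨⟨1/T⟩⟩
(x * y) .coeff n = ∑[ k < cauchyLength x y n ] cauchyTerm x y n (toℕ k)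
(x * y) .bound   = bound x ℤ.+ bound y
(x * y) .vanishes n b<n =
  trans (sum-cong-≗ {cauchyLength x y n} {λ k → cauchyTerm x y n (toℕ k)} {λ _ → 0ℚ}
          λ k → term≡0 (toℕ k))
        (sum-replicate-zero (cauchyLength x y n))
  where
  above : ∀ k → bound y ℤ.< n ℤ.- (bound x ℤ.- + k)
  above k = subst (ℤ._< n ℤ.- (bound x ℤ.- + k)) cancel
    (ℤₚ.+-mono-<-≤ b<n (ℤₚ.neg-mono-≤ (ℤₚ.i-j≤i (bound x) (+ k))))
    where
    cancel : bound x ℤ.+ bound y ℤ.- bound x ≡ bound y
    cancel = trans (cong (ℤ._- bound x) (ℤₚ.+-comm (bound x) (bound y)))
      (trans (ℤₚ.+-assoc (bound y) (bound x) (ℤ.- bound x))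
        (trans (cong (λ z → bound y ℤ.+ z) (ℤₚ.+-inverseʳ (bound x)))
          (ℤₚ.+-identityʳ (bound y))))
  term≡0 : ∀ k → cauchyTerm x y n k ≡ 0ℚ
  term≡0 k = trans (cong (coeff x (bound x ℤ.- + k) ℚ.*_) (vanishes y _ (above k)))
    (ℚₚ.*-zeroʳ (coeff x (bound x ℤ.- + k)))

-1^_ : ℤ → ℚ⟨⟨1/T⟩⟩
-1^ i with parity ∣ i ∣
... | 0ℙ = 1#
... | 1ℙ = - 1#

-- In a field, z = x / y.
_IsQuotient_/_ : ℚ⟨⟨1/T⟩⟩ → ℚ⟨⟨1/T⟩⟩ → ℚ⟨⟨1/T⟩⟩ → Set
z IsQuotient x / y = ¬ (y ≈ 0#) × y * z ≈ x

-- Degrees lie in ℤ ∪ {-∞} = ℤ ₋.  Whether a series is zero is not decidable,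
-- so the degree is given as a (single-valued) relation.

data HasDegree (x : ℚ⟨⟨1/T⟩⟩) : ℤ ₋ → Set where
  isZero  : x ≈ 0# → HasDegree x ⊥₋
  leading : ∀ {n} → ¬ (coeff x n ≡ 0ℚ) → (∀ m → n ℤ.< m → coeff x m ≡ 0ℚ) →
            HasDegree x [ n ]

-- ℚ[T] as a subring of ℚ⟨⟨1/T⟩⟩.

record ℚ[T] : Set where
  field
    series     : ℚ⟨⟨1/T⟩⟩
    polynomial : ∀ n → n ℤ.< 0ℤ → coeff series n ≡ 0ℚ

open ℚ[T] public

constₚ : ℚ → ℚ[T]
constₚ q .series = const q
constₚ q .polynomial -[1+ _ ] _ = refl
constₚ q .polynomial (+ _) (ℤ.+<+ ())

0ₚ 1ₚ -1ₚ : ℚ[T]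
0ₚ  = constₚ 0ℚ
1ₚ  = constₚ 1ℚ
-1ₚ = constₚ (ℚ.- 1ℚ)

_∈ℚ⟨T⟩ : ℚ⟨⟨1/T⟩⟩ → Set
x ∈ℚ⟨T⟩ = ∃[ p ] ∃[ q ] x IsQuotient series p / series q

record BinaryQuadraticForm : Set where
  field
    a b c        : ℚ⟨⟨1/T⟩⟩
    notAllInℚ⟨T⟩ : ¬ (a ∈ℚ⟨T⟩ × b ∈ℚ⟨T⟩ × c ∈ℚ⟨T⟩)

open BinaryQuadraticForm public

_⟨_,_⟩ : BinaryQuadraticForm → ℚ⟨⟨1/T⟩⟩ → ℚ⟨⟨1/T⟩⟩ → ℚ⟨⟨1/T⟩⟩
Q ⟨ x , y ⟩ = a Q * (x * x) + b Q * (x * y) + c Q * (y * y)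

HasCoefficients : BinaryQuadraticForm → (A B C : ℚ⟨⟨1/T⟩⟩) → Set
HasCoefficients Q A B C = a Q ≈ A × b Q ≈ B × c Q ≈ C

disc : BinaryQuadraticForm → ℚ⟨⟨1/T⟩⟩
disc Q = b Q * b Q - 4# * (a Q * c Q)

Indefinite : BinaryQuadraticForm → Set
Indefinite Q = ¬ (disc Q ≈ 0#) × ∃[ r ] r * r ≈ disc Q

-- In the following, r is the fixed square root of the discriminant.

IsFirstRoot IsSecondRoot : (r : ℚ⟨⟨1/T⟩⟩) → BinaryQuadraticForm → ℚ⟨⟨1/T⟩⟩ → Set
IsFirstRoot  r Q f = f IsQuotient (r - b Q) / (2# * a Q)
IsSecondRoot r Q s = s IsQuotient (- r - b Q) / (2# * a Q)

record Reduced (r : ℚ⟨⟨1/T⟩⟩) (Q : BinaryQuadraticForm) : Set where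
  field
    a≉0          : ¬ (a Q ≈ 0#)
    f s          : ℚ⟨⟨1/T⟩⟩
    isFirstRoot  : IsFirstRoot r Q f
    isSecondRoot : IsSecondRoot r Q s
    f≉0          : ¬ (f ≈ 0#)
    deg-f deg-s  : ℤ ₋
    hasDegree-f  : HasDegree f deg-f
    hasDegree-s  : HasDegree s deg-s
    deg-f<0      : deg-f <₋ [ 0ℤ ]
    0<deg-s      : [ 0ℤ ] <₋ deg-s

-- The matrix with rows (α , β) and (γ , δ).

record Matrix : Set where
  constructor mat
  field
    α β γ δ : ℚ[T]

det : Matrix → ℚ⟨⟨1/T⟩⟩
det (mat α β γ δ) = series α * series δ - series β * series γ

-- Q′ (X , Y) = Q (α X + β Y , γ X + δ Y), comparing the coefficients of
-- X², X Y and Y².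

Transforms : Matrix → BinaryQuadraticForm → BinaryQuadraticForm → Set
Transforms (mat α′ β′ γ′ δ′) Q Q′ = HasCoefficients Q′
  (Q ⟨ α , γ ⟩)
  (2# * (a Q * (α * β)) + b Q * (α * δ + β * γ) + 2# * (c Q * (γ * δ)))
  (Q ⟨ β , δ ⟩)
  where
  α = series α′ ; β = series β′ ; γ = series γ′ ; δ = series δ′

ProperlyEquivalent : BinaryQuadraticForm → BinaryQuadraticForm → Set
ProperlyEquivalent Q Q′ = ∃[ M ] det M ≈ 1# × Transforms M Q Q′

IsLowerBound : Pred (ℤ ₋) 0ℓ → ℤ ₋ → Set
IsLowerBound S m = ∀ d → d ∈ S → m ≤₋ d

IsInfimum : Pred (ℤ ₋) 0ℓ → ℤ ₋ → Set
IsInfimum S m = IsLowerBound S m × (∀ l → IsLowerBound S l → l ≤₋ m)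

DegreesOfValues : BinaryQuadraticForm → Pred (ℤ ₋) 0ℓ
DegreesOfValues Q d = ∃[ X ] ∃[ Y ]
  ¬ (series X ≈ 0# × series Y ≈ 0#) × HasDegree (Q ⟨ series X , series Y ⟩) d

DegreesOfFamily : (ℤ → ℚ⟨⟨1/T⟩⟩) → Pred (ℤ ₋) 0ℓ
DegreesOfFamily A d = ∃[ i ] HasDegree (A i) d

-- m(Q) = m.
IsMinimum : BinaryQuadraticForm → ℤ ₋ → Set
IsMinimum Q = IsInfimum (DegreesOfValues Q)

-- An equality inf S = inf S′ is expressed as "every m is an infimum of S iff
-- it is one of S′".  This is not vacuous: classically, every inhabited set of
-- degrees has an infimum.

¬¬infimum : (S : Pred (ℤ ₋) 0ℓ) → ∃ S → ¬ ¬ ∃ (IsInfimum S)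
¬¬infimum S (⊥₋ , ⊥∈S) none =
  none (⊥₋ , (λ d _ → ⊥₋≤ d) , λ l l-lb → l-lb ⊥₋ ⊥∈S)
¬¬infimum S ([ n ] , n∈S) none =
  none (⊥₋ , (λ d _ → ⊥₋≤ d) , λ where
    ⊥₋    _    → ⊥₋≤ ⊥₋
    [ e ] e-lb → ⊥-elim (climb e e-lb (suc ∣ n ℤ.- e ∣) (beyond e)))
  where
  step : ∀ e → IsLowerBound S [ e ] → ¬ ¬ IsLowerBound S [ ℤ.suc e ]
  step e e-lb ¬suc-lb = none ([ e ] , e-lb , λ where
    ⊥₋    _    → ⊥₋≤ [ e ]
    [ l ] l-lb → [ ℤₚ.≮⇒≥ (λ e<l → ¬suc-lb λ d d∈S →
      ≤₋-trans ℤₚ.≤-trans [ ℤₚ.i<j⇒suc[i]≤j e<l ] (l-lb d d∈S)) ])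

  climb : ∀ e → IsLowerBound S [ e ] → ∀ k → ¬ ¬ IsLowerBound S [ + k ℤ.+ e ]
  climb e e-lb zero    ¬lb = ¬lb (subst (λ z → IsLowerBound S [ z ]) (sym (ℤₚ.+-identityˡ e)) e-lb)
  climb e e-lb (suc k) ¬lb = climb e e-lb k λ lb → step (+ k ℤ.+ e) lb λ lb′ →
    ¬lb (subst (λ z → IsLowerBound S [ z ]) (sym (ℤₚ.+-assoc 1ℤ (+ k) e)) lb′)

  n≤∣n-e∣+e : ∀ e → n ℤ.≤ + ∣ n ℤ.- e ∣ ℤ.+ e
  n≤∣n-e∣+e e = ℤₚ.≤-trans (ℤₚ.≤-reflexive (sym cancel))
    (ℤₚ.+-monoˡ-≤ e (i≤∣i∣ (n ℤ.- e)))
    where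
    cancel : n ℤ.- e ℤ.+ e ≡ n
    cancel = trans (ℤₚ.+-assoc n (ℤ.- e) e)
      (trans (cong (λ z → n ℤ.+ z) (ℤₚ.+-inverseˡ e)) (ℤₚ.+-identityʳ n))
    i≤∣i∣ : ∀ i → i ℤ.≤ + ∣ i ∣
    i≤∣i∣ (+ _)    = ℤₚ.≤-refl
    i≤∣i∣ -[1+ _ ] = ℤ.-≤+

  beyond : ∀ e → ¬ IsLowerBound S [ + suc ∣ n ℤ.- e ∣ ℤ.+ e ]
  beyond e lb with lb [ n ] n∈S
  ... | [ le ] = ℤₚ.<-irrefl refl (ℤₚ.<-≤-trans
    (ℤₚ.≤-<-trans (n≤∣n-e∣+e e) (ℤₚ.+-monoˡ-< e (ℤ.+<+ (ℕ.s≤s ℕₚ.≤-refl)))) le)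

{-# OPTIONS --safe #-}
module Submission where

-- Let r be the fixed square root of D.  Reducedness of Φᵢ = (a, b, c) says that
-- b and r have the same leading term and that deg a, deg c < deg b, so if
-- deg X ≤ deg Y, the value a X² + b X Y + c Y² has degree at least deg c unless
-- the leading terms of b X Y and c Y² cancel.  In that case Φᵢ₊₁ takes the
-- same value at (δ X - Y , X), where deg (δ X - Y) ≤ deg X < deg Y, and one
-- descends.  If deg Y ≤ deg X, one exchanges the variables and descends
-- through Φᵢ₋₁ instead.  So no value has degree below all the deg Aᵢ.

open import Level using (0ℓ)
open import Algebra.Bundles using (CommutativeRing)
import Algebra.Properties.Ring as RingProperties
import Algebra.Solver.Ring as RingSolver
open import Algebra.Solver.Ring.AlmostCommutativeRing
  using (fromCommutativeRing; _-Raw-AlmostCommutative⟶_)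
open import Data.Empty using (⊥; ⊥-elim)
open import Data.Fin.Base using (toℕ)
open import Data.Integer.Base as ℤ using (ℤ; +_; +0; +[1+_]; -[1+_]; ∣_∣; 0ℤ; 1ℤ)
import Data.Integer.Properties as ℤₚ
import Data.Integer.Tactic.RingSolver as ℤ-Solver
import Data.Maybe.Base as Maybe
open import Data.Nat.Base as ℕ using (ℕ; zero; suc; parity)
open import Data.Parity.Base using (0ℙ; 1ℙ)
open import Data.Product.Base using (∃-syntax; _×_; _,_; proj₁; proj₂)
open import Data.Rational.Base as ℚ using (ℚ; 0ℚ; 1ℚ; ½)
import Data.Rational.Properties as ℚₚ
open import Data.Rational.Solver using (module +-*-Solver)
open import Data.Sum.Base using (_⊎_; inj₁; inj₂)
open import Algebra.Properties.CommutativeMonoid.Sum ℚₚ.+-0-commutativeMonoid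
  using (sum-syntax)
open import Function.Base using (_∘_)
open import Function.Bundles using (_⇔_; mk⇔; Equivalence)
open import Relation.Binary.Definitions using (tri<; tri≈; tri>)
open import Relation.Binary.PropositionalEquality
  using (_≡_; _≢_; refl; cong; cong₂; sym; trans; subst; subst₂; module ≡-Reasoning)
open import Relation.Nullary.Decidable using (yes; no; dec⇒maybe; decidable-stable)
open import Relation.Nullary.Negation.Core using (¬_)
open import Relation.Unary using (Pred; _∈_)

-- Binary quadratic forms over an abstract ring

-- An infimum is determined by its set of lower bounds, so the theorem reduces to two sets of
-- degrees having the same lower bounds. One direction is immediate, each ±Aᵢ being a value. For the
-- other, let L bound all deg Aᵢ from below and suppose that some value v has degree below L. This v
-- stays fixed while the form and the variables change, and any term that dominates v in degree L or
-- above is absurd. The descent stops because a nonzero polynomial has degree at least 0.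
--
-- The obstacle is that neither the vanishing of a series nor its degree can be decided. Leading
-- terms therefore exist only under double negation, which does no harm because the descent aims at
-- ⊥. Allowing the coefficient in `Lead` to be 0 lets one notion express both exact degrees and
-- strict upper bounds: `Lead v L 0ℚ` says deg v < L.

*-≢0 : ∀ {p q} → p ≢ 0ℚ → q ≢ 0ℚ → p ℚ.* q ≢ 0ℚ
*-≢0 {p} {q} p≢0 q≢0 pq≡0 = q≢0 (begin
  q                      ≡⟨ ℚₚ.*-identityˡ q ⟨
  1ℚ ℚ.* q               ≡⟨ cong (ℚ._* q) (ℚₚ.*-inverseˡ p) ⟨
  ℚ.1/ p ℚ.* p ℚ.* q     ≡⟨ ℚₚ.*-assoc (ℚ.1/ p) p q ⟩
  ℚ.1/ p ℚ.* (p ℚ.* q)   ≡⟨ cong (ℚ.1/ p ℚ.*_) pq≡0 ⟩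
  ℚ.1/ p ℚ.* 0ℚ          ≡⟨ ℚₚ.*-zeroʳ (ℚ.1/ p) ⟩
  0ℚ                     ∎)
  where
  open ≡-Reasoning
  instance
    p-nonZero = ℚ.≢-nonZero p≢0

module ℚ-identities where
  open +-*-Solver

  neg-involutive : ∀ p → p ≡ ℚ.- (ℚ.- p)
  neg-involutive = solve 1 (λ p → p := :- (:- p)) refl

  +-cancel : ∀ p → p ≡ p ℚ.+ p ℚ.- p
  +-cancel = solve 1 (λ p → p := p :+ p :- p) refl

  ½-2 : ∀ p q → ½ ℚ.* (0ℚ ℚ.+ ℚ.- ((+ 2) ℚ./ 1 ℚ.* p ℚ.* q)) ≡ ℚ.- (p ℚ.* q)
  ½-2 = solve 2 (λ p q →
    con ½ :* (con 0ℚ :+ :- (con ((+ 2) ℚ./ 1) :* p :* q)) := :- (p :* q)) refl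

  ½-neg : ∀ r → ½ ℚ.* (ℚ.- r ℚ.+ ℚ.- r) ≡ ℚ.- r
  ½-neg = solve 1 (λ r → con ½ :* (:- r :+ :- r) := :- r) refl

  -- Removes a factor y from the equation saying that the leading terms of b X Y and c Y² cancel;
  -- the 0ℚ is the contribution of a X².
  tie : ∀ r c x y → (ℚ.- r ℚ.* x ℚ.+ ℚ.- (c ℚ.* y)) ℚ.* y ≡
        ℚ.- (0ℚ ℚ.+ r ℚ.* (x ℚ.* y) ℚ.+ c ℚ.* (y ℚ.* y))
  tie = solve 4 (λ r c x y → (:- r :* x :+ :- (c :* y)) :* y :=
    :- (con 0ℚ :+ r :* (x :* y) :+ c :* (y :* y))) refl

*-≡0 : ∀ {p q} → p ≡ 0ℚ ⊎ q ≡ 0ℚ → p ℚ.* q ≡ 0ℚ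
*-≡0 {q = q} (inj₁ refl) = ℚₚ.*-zeroˡ q
*-≡0 {p = p} (inj₂ refl) = ℚₚ.*-zeroʳ p

-‿≢0 : ∀ {p} → p ≢ 0ℚ → ℚ.- p ≢ 0ℚ
-‿≢0 {p} p≢0 -p≡0 = p≢0 (trans (ℚ-identities.neg-involutive p) (cong ℚ.-_ -p≡0))

-- The identities below need only ring operations and rational constants, ½ among them. With the
-- ring abstract, `_≈_` does not unfold to equations between coefficients.
module QuadraticForms
  (R : CommutativeRing 0ℓ 0ℓ)
  (const-homo : ℚₚ.+-*-rawRing -Raw-AlmostCommutative⟶ fromCommutativeRing R)
  where

  open CommutativeRing R renaming (refl to ≈-refl; sym to ≈-sym; trans to ≈-trans)
  open _-Raw-AlmostCommutative⟶_ const-homo public using () renaming (⟦_⟧ to const)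

  open RingSolver ℚₚ.+-*-rawRing (fromCommutativeRing R) const-homo
    (λ p q → Maybe.map (λ p≡q → reflexive (cong const p≡q)) (dec⇒maybe (p ℚₚ.≟ q)))
    using (solve; _:=_; _:+_; _:*_; :-_; _:-_; con)

  2# : Carrier
  2# = const ((+ 2) ℚ./ 1)

  ⟪_,_,_⟫ : (a b c X Y : Carrier) → Carrier
  ⟪ a , b , c ⟫ X Y = a * (X * X) + b * (X * Y) + c * (Y * Y)

  ⟪⟫-cong : ∀ {a b c a′ b′ c′ X Y X′ Y′} → a ≈ a′ → b ≈ b′ → c ≈ c′ → X ≈ X′ → Y ≈ Y′ →
            ⟪ a , b , c ⟫ X Y ≈ ⟪ a′ , b′ , c′ ⟫ X′ Y′
  ⟪⟫-cong a≈ b≈ c≈ X≈ Y≈ = +-cong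
    (+-cong (*-cong a≈ (*-cong X≈ X≈)) (*-cong b≈ (*-cong X≈ Y≈)))
    (*-cong c≈ (*-cong Y≈ Y≈))

  transform-value : ∀ a b c {a′ b′ c′} α β γ δ X Y →
    a′ ≈ ⟪ a , b , c ⟫ α γ →
    b′ ≈ 2# * (a * (α * β)) + b * (α * δ + β * γ) + 2# * (c * (γ * δ)) →
    c′ ≈ ⟪ a , b , c ⟫ β δ →
    ⟪ a′ , b′ , c′ ⟫ X Y ≈ ⟪ a , b , c ⟫ (α * X + β * Y) (γ * X + δ * Y)
  transform-value a b c α β γ δ X Y a′≈ b′≈ c′≈ = ≈-trans
    (⟪⟫-cong a′≈ b′≈ c′≈ (≈-refl {X}) (≈-refl {Y}))
    (solve 9 (λ a b c α β γ δ X Y →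
      let 2′ = con ((+ 2) ℚ./ 1)
          q = λ x y → a :* (x :* x) :+ b :* (x :* y) :+ c :* (y :* y)
      in q α γ :* (X :* X)
         :+ (2′ :* (a :* (α :* β)) :+ b :* (α :* δ :+ β :* γ) :+ 2′ :* (c :* (γ :* δ))) :* (X :* Y)
         :+ q β δ :* (Y :* Y)
         := q (α :* X :+ β :* Y) (γ :* X :+ δ :* Y))
      ≈-refl a b c α β γ δ X Y)

  module _ {α β γ δ} (det≈1 : α * δ - β * γ ≈ 1#) where

    private
      det-* : ∀ X → (α * δ - β * γ) * X ≈ X
      det-* X = ≈-trans (*-cong det≈1 ≈-refl) (*-identityˡ X)

    -- The arguments come from the adjugate of the matrix, which is its inverse as the determinant
    -- is 1. So every pair is an image.
    solve-X : ∀ X Y → α * (δ * X - β * Y) + β * (α * Y - γ * X) ≈ X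
    solve-X X Y = ≈-trans
      (solve 6 (λ α β γ δ X Y → α :* (δ :* X :- β :* Y) :+ β :* (α :* Y :- γ :* X)
                 := (α :* δ :- β :* γ) :* X) ≈-refl α β γ δ X Y)
      (det-* X)

    solve-Y : ∀ X Y → γ * (δ * X - β * Y) + δ * (α * Y - γ * X) ≈ Y
    solve-Y X Y = ≈-trans
      (solve 6 (λ α β γ δ X Y → γ :* (δ :* X :- β :* Y) :+ δ :* (α :* Y :- γ :* X)
                 := (α :* δ :- β :* γ) :* Y) ≈-refl α β γ δ X Y)
      (det-* Y)

    -- The adjugate recovers X and Y as combinations of the entries of the image. This keeps nonzero
    -- pairs nonzero.
    image≈0⇒≈0 : ∀ {X Y} → α * X + β * Y ≈ 0# → γ * X + δ * Y ≈ 0# → X ≈ 0# × Y ≈ 0#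
    image≈0⇒≈0 {X} {Y} U≈0 V≈0 =
        combine δ β (≈-trans (≈-sym (det-* X))
          (solve 6 (λ α β γ δ X Y → (α :* δ :- β :* γ) :* X :=
             δ :* (α :* X :+ β :* Y) :- β :* (γ :* X :+ δ :* Y)) ≈-refl α β γ δ X Y))
          U≈0 V≈0
      , combine α γ (≈-trans (≈-sym (det-* Y))
          (solve 6 (λ α β γ δ X Y → (α :* δ :- β :* γ) :* Y :=
             α :* (γ :* X :+ δ :* Y) :- γ :* (α :* X :+ β :* Y)) ≈-refl α β γ δ X Y))
          V≈0 U≈0
      where
      combine : ∀ p q {Z U V} → Z ≈ p * U - q * V → U ≈ 0# → V ≈ 0# → Z ≈ 0#
      combine p q Z≈ U≈0 V≈0 = ≈-trans Z≈ (≈-trans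
        (+-cong (≈-trans (*-cong ≈-refl U≈0) (zeroʳ p))
          (-‿cong (≈-trans (*-cong ≈-refl V≈0) (zeroʳ q))))
        (-‿inverseʳ 0#))

  -- The effect of the matrix (0 1; -1 δ) on the coefficients.
  record Step (a b c δ a′ b′ c′ : Carrier) : Set where
    field
      a′≈ : a′ ≈ c
      b′≈ : b′ ≈ - b - 2# * (c * δ)
      c′≈ : c′ ≈ a + b * δ + c * (δ * δ)

  open Step public

  -- Exchanging the variables turns the inverse of a step into a step.
  reverse : ∀ {a b c δ a′ b′ c′} → Step a b c δ a′ b′ c′ → Step c′ b′ a′ δ c b a
  reverse {a} {b} {c} {δ} s = record
    { a′≈ = ≈-sym (a′≈ s)
    ; b′≈ = ≈-sym (≈-trans
        (+-cong (-‿cong (b′≈ s)) (-‿cong (*-cong ≈-refl (*-cong (a′≈ s) ≈-refl))))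
        (solve 3 (λ b c δ → :- (:- b :- con ((+ 2) ℚ./ 1) :* (c :* δ))
                     :- con ((+ 2) ℚ./ 1) :* (c :* δ) := b) ≈-refl b c δ))
    ; c′≈ = ≈-sym (≈-trans
        (+-cong (+-cong (c′≈ s) (*-cong (b′≈ s) ≈-refl)) (*-cong (a′≈ s) ≈-refl))
        (solve 4 (λ a b c δ → (a :+ b :* δ :+ c :* (δ :* δ))
                     :+ (:- b :- con ((+ 2) ℚ./ 1) :* (c :* δ)) :* δ :+ c :* (δ :* δ) := a)
          ≈-refl a b c δ))
    }

  -- The new arguments are the image of (X , Y) under (δ -1; 1 0), the inverse of (0 1; -1 δ).
  step-value : ∀ {a b c δ a′ b′ c′} → Step a b c δ a′ b′ c′ → ∀ X Y →
               ⟪ a , b , c ⟫ X Y ≈ ⟪ a′ , b′ , c′ ⟫ (δ * X - Y) X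
  step-value {a} {b} {c} {δ} s X Y = ≈-sym (≈-trans
    (⟪⟫-cong (a′≈ s) (b′≈ s) (c′≈ s) ≈-refl ≈-refl)
    (solve 6 (λ a b c δ X Y →
        c :* ((δ :* X :- Y) :* (δ :* X :- Y))
        :+ (:- b :- con ((+ 2) ℚ./ 1) :* (c :* δ)) :* ((δ :* X :- Y) :* X)
        :+ (a :+ b :* δ :+ c :* (δ :* δ)) :* (X :* X)
        := a :* (X :* X) :+ b :* (X :* Y) :+ c :* (Y :* Y))
      ≈-refl a b c δ X Y))

  -- The formula for b′ is solved for c δ, so the two middle coefficients alone give the leading
  -- term of c δ.
  step-product : ∀ {a b c δ a′ b′ c′} → Step a b c δ a′ b′ c′ →
                 c * δ ≈ const ½ * (- b - b′)
  step-product {a} {b} {c} {δ} s = ≈-sym (≈-trans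
    (*-cong ≈-refl (+-cong ≈-refl (-‿cong (b′≈ s))))
    (solve 3 (λ b c δ → con ½ :* (:- b :- (:- b :- con ((+ 2) ℚ./ 1) :* (c :* δ))) := c :* δ)
      ≈-refl b c δ))

  transform⇒step : ∀ {a b c δ a′ b′ c′} →
    a′ ≈ ⟪ a , b , c ⟫ (const 0ℚ) (const (ℚ.- 1ℚ)) →
    b′ ≈ 2# * (a * (const 0ℚ * const 1ℚ)) + b * (const 0ℚ * δ + const 1ℚ * const (ℚ.- 1ℚ))
         + 2# * (c * (const (ℚ.- 1ℚ) * δ)) →
    c′ ≈ ⟪ a , b , c ⟫ (const 1ℚ) δ →
    Step a b c δ a′ b′ c′
  transform⇒step {a} {b} {c} {δ} a′≈ b′≈ c′≈ = record
    { a′≈ = ≈-trans a′≈ (solve 3 (λ a b c →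
        a :* (con 0ℚ :* con 0ℚ) :+ b :* (con 0ℚ :* con (ℚ.- 1ℚ))
        :+ c :* (con (ℚ.- 1ℚ) :* con (ℚ.- 1ℚ)) := c)
        ≈-refl a b c)
    ; b′≈ = ≈-trans b′≈ (solve 4 (λ a b c δ →
        con ((+ 2) ℚ./ 1) :* (a :* (con 0ℚ :* con 1ℚ))
        :+ b :* (con 0ℚ :* δ :+ con 1ℚ :* con (ℚ.- 1ℚ))
        :+ con ((+ 2) ℚ./ 1) :* (c :* (con (ℚ.- 1ℚ) :* δ))
        := :- b :- con ((+ 2) ℚ./ 1) :* (c :* δ)) ≈-refl a b c δ)
    ; c′≈ = ≈-trans c′≈ (solve 4 (λ a b c δ →
        a :* (con 1ℚ :* con 1ℚ) :+ b :* (con 1ℚ :* δ) :+ c :* (δ :* δ)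
        := a :+ b :* δ :+ c :* (δ :* δ)) ≈-refl a b c δ)
    }

  swap-value : ∀ a b c X Y → ⟪ a , b , c ⟫ X Y ≈ ⟪ c , b , a ⟫ Y X
  swap-value = solve 5 (λ a b c X Y →
    a :* (X :* X) :+ b :* (X :* Y) :+ c :* (Y :* Y)
    := c :* (Y :* Y) :+ b :* (Y :* X) :+ a :* (X :* X)) ≈-refl

  value-at-⟨0,Y⟩ : ∀ a b c {X} Y → X ≈ 0# → ⟪ a , b , c ⟫ X Y ≈ c * (Y * Y)
  value-at-⟨0,Y⟩ a b c Y X≈0 = ≈-trans
    (⟪⟫-cong ≈-refl ≈-refl ≈-refl (≈-trans X≈0 (≈-sym 0-homo)) ≈-refl)
    (solve 4 (λ a b c Y →
      a :* (con 0ℚ :* con 0ℚ) :+ b :* (con 0ℚ :* Y) :+ c :* (Y :* Y) := c :* (Y :* Y))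
      ≈-refl a b c Y)
    where open _-Raw-AlmostCommutative⟶_ const-homo using (0-homo)

  distribˡ-assoc : ∀ c δ X Y → c * (δ * X - Y) ≈ c * δ * X - c * Y
  distribˡ-assoc = solve 4 (λ c δ X Y → c :* (δ :* X :- Y) := c :* δ :* X :- c :* Y) ≈-refl

  half-sum : ∀ {x y r b} → x ≈ r - b → y ≈ - r - b →
             r ≈ const ½ * (x - y) × b ≈ const ½ * (- x - y)
  half-sum {x} {y} {r} {b} x≈ y≈ =
      ≈-trans (solve 2 (λ r b → r := con ½ :* ((r :- b) :- (:- r :- b))) ≈-refl r b)
        (*-cong ≈-refl (+-cong (≈-sym x≈) (-‿cong (≈-sym y≈))))
    , ≈-trans (solve 2 (λ r b → b := con ½ :* (:- (r :- b) :- (:- r :- b))) ≈-refl r b)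
        (*-cong ≈-refl (+-cong (-‿cong (≈-sym x≈)) (-‿cong (≈-sym y≈))))

  value-at-⟨1,0⟩ : ∀ a b c → ⟪ a , b , c ⟫ (const 1ℚ) (const 0ℚ) ≈ a
  value-at-⟨1,0⟩ = solve 3 (λ a b c →
    a :* (con 1ℚ :* con 1ℚ) :+ b :* (con 1ℚ :* con 0ℚ) :+ c :* (con 0ℚ :* con 0ℚ) := a) ≈-refl

  det-step : ∀ δ → const 0ℚ * δ - const 1ℚ * const (ℚ.- 1ℚ) ≈ 1#
  det-step δ = ≈-trans
    (solve 1 (λ δ → con 0ℚ :* δ :- con 1ℚ :* con (ℚ.- 1ℚ) := con 1ℚ) ≈-refl δ) 1-homo
    where open _-Raw-AlmostCommutative⟶_ const-homo using (1-homo)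

  -- Lead x n c stands for "deg x ≤ n and c is the coefficient of Tⁿ in x", where
  -- c may be 0.
  module Descent
    (Lead : Carrier → ℤ → ℚ → Set)
    (lead-cong : ∀ {x y n c} → x ≈ y → Lead x n c → Lead y n c)
    (lead-+ : ∀ {x y n c d} → Lead x n c → Lead y n d → Lead (x + y) n (c ℚ.+ d))
    (lead-neg : ∀ {x n c} → Lead x n c → Lead (- x) n (ℚ.- c))
    (lead-* : ∀ {x y m n c d} → Lead x m c → Lead y n d → Lead (x * y) (m ℤ.+ n) (c ℚ.* d))
    (lead-< : ∀ {x m n c} → Lead x m c → m ℤ.< n → Lead x n 0ℚ)
    (lead-unique : ∀ {x n c d} → Lead x n c → Lead x n d → c ≡ d)
    (lead-const : ∀ q → Lead (const q) 0ℤ q)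
    (¬lead⇒≈0 : ∀ x → ¬ (∃[ n ] ∃[ c ] c ≢ 0ℚ × Lead x n c) → x ≈ 0#)
    (Polynomial : Carrier → Set)
    (polynomial-+ : ∀ {x y} → Polynomial x → Polynomial y → Polynomial (x + y))
    (polynomial-neg : ∀ {x} → Polynomial x → Polynomial (- x))
    (polynomial-* : ∀ {x y} → Polynomial x → Polynomial y → Polynomial (x * y))
    (polynomial-degree : ∀ {x n c} → Polynomial x → c ≢ 0ℚ → Lead x n c → 0ℤ ℤ.≤ n)
    where

    lead-subst : ∀ {x m n c d} → m ≡ n → c ≡ d → Lead x m c → Lead x n d
    lead-subst refl refl lx = lx

    lead-≤ : ∀ {x m n} → Lead x m 0ℚ → m ℤ.≤ n → Lead x n 0ℚ
    lead-≤ {m = m} {n} lx m≤n with ℤₚ.<-cmp m n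
    ... | tri< m<n _ _ = lead-< lx m<n
    ... | tri≈ _ m≡n _ = lead-subst m≡n refl lx
    ... | tri> _ _ n<m = ⊥-elim (ℤₚ.<⇒≱ n<m m≤n)

    lead-scale : ∀ q {x n c} → Lead x n c → Lead (const q * x) n (q ℚ.* c)
    lead-scale q lx = lead-subst (ℤₚ.+-identityˡ _) refl (lead-* (lead-const q) lx)

    lead-zeroˡ : ∀ {x y m n d} → Lead x m 0ℚ → Lead y n d → Lead (x * y) (m ℤ.+ n) 0ℚ
    lead-zeroˡ {d = d} lx ly = lead-subst refl (ℚₚ.*-zeroˡ d) (lead-* lx ly)

    lead-zeroʳ : ∀ {x y m n c} → Lead x m c → Lead y n 0ℚ → Lead (x * y) (m ℤ.+ n) 0ℚ
    lead-zeroʳ {c = c} lx ly = lead-subst refl (ℚₚ.*-zeroʳ c) (lead-* lx ly)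

    degree-unique : ∀ {x m n c d} → c ≢ 0ℚ → Lead x m c → d ≢ 0ℚ → Lead x n d → m ≡ n
    degree-unique {m = m} {n} c≢0 lc d≢0 ld with ℤₚ.<-cmp m n
    ... | tri< m<n _ _ = ⊥-elim (d≢0 (lead-unique ld (lead-< lc m<n)))
    ... | tri≈ _ m≡n _ = m≡n
    ... | tri> _ _ n<m = ⊥-elim (c≢0 (lead-unique lc (lead-< ld n<m)))

    -- Additivity is enough: x + x ≈ x makes c + c equal to c.
    ≈0⇒¬lead : ∀ {x n c} → x ≈ 0# → c ≢ 0ℚ → ¬ Lead x n c
    ≈0⇒¬lead {x} {n} {c} x≈0 c≢0 lx = c≢0 (trans (ℚ-identities.+-cancel c)
      (trans (cong (λ d → d ℚ.- c)
        (sym (lead-unique lx (lead-cong x+x≈x (lead-+ lx lx)))))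
        (ℚₚ.+-inverseʳ c)))
      where
      x+x≈x : x + x ≈ x
      x+x≈x = ≈-trans (+-cong x≈0 ≈-refl) (+-identityˡ x)

    -- The substitute for deciding whether a series vanishes; it is applied only on the way to ⊥.
    ¬¬zero-or-lead : ∀ x → ¬ ¬ (x ≈ 0# ⊎ (∃[ n ] ∃[ c ] c ≢ 0ℚ × Lead x n c))
    ¬¬zero-or-lead x neither = neither (inj₁ (¬lead⇒≈0 x λ l → neither (inj₂ l)))

    value-lead : ∀ {a b c X Y n u v w} →
      Lead (a * (X * X)) n u → Lead (b * (X * Y)) n v → Lead (c * (Y * Y)) n w →
      Lead (⟪ a , b , c ⟫ X Y) n (u ℚ.+ v ℚ.+ w)
    value-lead lu lv lw = lead-+ (lead-+ lu lv) lw

    -- As deg f < 0 < deg s, r - b = 2 a f is of lower degree than - r - b = 2 a s.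
    reduced-lead : ∀ {r a b f s α a₀ σ s₀} →
      2# * a * f ≈ r - b → 2# * a * s ≈ - r - b →
      a₀ ≢ 0ℚ → Lead a α a₀ → Lead f 0ℤ 0ℚ → s₀ ≢ 0ℚ → Lead s σ s₀ → 0ℤ ℤ.< σ →
      ∃[ ρ ] ∃[ r₀ ] r₀ ≢ 0ℚ × α ℤ.< ρ × Lead r ρ r₀ × Lead b ρ r₀
    reduced-lead {r} {a} {b} {f} {s} {α} {a₀} {σ} {s₀} eq-f eq-s a₀≢0 la lf s₀≢0 ls 0<σ =
        -- At this exponent - r - b = 2 a s has coefficient 2 a₀ s₀ and r - b has 0. Half their
        -- difference gives r, half their negated sum gives b: both times - a₀ s₀.
        α ℤ.+ σ , ℚ.- (a₀ ℚ.* s₀) , -‿≢0 (*-≢0 a₀≢0 s₀≢0)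
      , α<α+σ
      , lead-subst refl (ℚ-identities.½-2 a₀ s₀)
          (lead-cong (≈-sym (proj₁ halves)) (lead-scale ½ (lead-+ l2af (lead-neg l2as))))
      , lead-subst refl (ℚ-identities.½-2 a₀ s₀)
          (lead-cong (≈-sym (proj₂ halves)) (lead-scale ½ (lead-+ (lead-neg l2af) (lead-neg l2as))))
      where
      halves = half-sum eq-f eq-s
      α<α+σ : α ℤ.< α ℤ.+ σ
      α<α+σ = subst (ℤ._< α ℤ.+ σ) (ℤₚ.+-identityʳ α) (ℤₚ.+-monoʳ-< α 0<σ)
      l2af : Lead (2# * a * f) (α ℤ.+ σ) 0ℚ
      l2af = lead-≤ (lead-zeroʳ (lead-scale _ la) lf) (ℤₚ.+-monoʳ-≤ α (ℤₚ.<⇒≤ 0<σ))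
      l2as : Lead (2# * a * s) (α ℤ.+ σ) ((+ 2) ℚ./ 1 ℚ.* a₀ ℚ.* s₀)
      l2as = lead-* (lead-scale _ la) ls

    -- What the descent uses of a form, (ρ , r₀) being the leading term of the root. The conditions
    -- are asymmetric because for deg X ≤ deg Y the term a X² is dominated by b X Y: an upper bound
    -- for deg a suffices, while the leading term of c must be known.
    record Admissible (L ρ : ℤ) (r₀ : ℚ) (a b c : Carrier) : Set where
      field
        a-small : Lead a ρ 0ℚ
        b-lead  : Lead b ρ r₀
        γ       : ℤ
        c₀      : ℚ
        c₀≢0    : c₀ ≢ 0ℚ
        c-lead  : Lead c γ c₀
        L≤γ     : L ℤ.≤ γ
        γ<ρ     : γ ℤ.< ρ

    -- The leading terms of c δ and - b agree.  So when those of b X Y and c Y²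
    -- cancel, those of c δ X and c Y agree, whence deg (δ X - Y) < deg Y.  The
    -- sharper bound deg (δ X - Y) ≤ deg X holds because otherwise b X Y would
    -- dominate in the next form.
    module _ {L ρ : ℤ} {r₀ : ℚ} (r₀≢0 : r₀ ≢ 0ℚ) (a b c δ : ℕ → Carrier)
      (step : ∀ n → Step (a n) (b n) (c n) (δ n) (a (suc n)) (b (suc n)) (c (suc n)))
      (admissible : ∀ n → ¬ ¬ Admissible L ρ r₀ (a n) (b n) (c n))
      (δ-polynomial : ∀ n → Polynomial (δ n))
      {v : Carrier} (v-small : Lead v L 0ℚ)
      where

      too-large : ∀ {n d} → L ℤ.≤ n → Lead v n d → d ≡ 0ℚ
      too-large L≤n lv = lead-unique lv (lead-≤ v-small L≤n)

      -- Induction on k, a strict upper bound for deg Y. The condition on deg X is asked of every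
      -- possible leading term, so that it also covers X ≈ 0#.
      descend : ∀ k n {X Y y y₀} → Polynomial X → Polynomial Y →
        y₀ ≢ 0ℚ → Lead Y y y₀ → (∀ {x x₀} → x₀ ≢ 0ℚ → Lead X x x₀ → x ℤ.≤ y) → y ℤ.< + k →
        v ≈ ⟪ a n , b n , c n ⟫ X Y → ⊥
      descend zero    n pX pY y₀≢0 lY x≤y y<k v≈ =
        ℤₚ.<⇒≱ y<k (polynomial-degree pY y₀≢0 lY)
      descend (suc k) n {X} {Y} {y} {y₀} pX pY y₀≢0 lY x≤y y<k v≈ =
        admissible n λ gₙ → admissible (suc n) λ gₙ₊₁ → ¬¬zero-or-lead X λ where
          (inj₁ X≈0) → X≈0-case gₙ X≈0
          (inj₂ (x , x₀ , x₀≢0 , lX)) → lead-case gₙ gₙ₊₁ x₀≢0 lX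
        where
        0≤y = polynomial-degree pY y₀≢0 lY
        L≤γ+2z : ∀ {γ z} → L ℤ.≤ γ → 0ℤ ℤ.≤ z → L ℤ.≤ γ ℤ.+ (z ℤ.+ z)
        L≤γ+2z {γ} {z} L≤γ 0≤z = ℤₚ.≤-trans L≤γ
          (subst (ℤ._≤ γ ℤ.+ (z ℤ.+ z)) (ℤₚ.+-identityʳ γ)
            (ℤₚ.+-monoʳ-≤ γ (ℤₚ.+-mono-≤ 0≤z 0≤z)))

        X≈0-case : Admissible L ρ r₀ (a n) (b n) (c n) → X ≈ 0# → ⊥
        X≈0-case gₙ X≈0 = *-≢0 c₀≢0 (*-≢0 y₀≢0 y₀≢0) (too-large (L≤γ+2z L≤γ 0≤y)
          (lead-cong (≈-sym (≈-trans v≈ (value-at-⟨0,Y⟩ _ _ _ Y X≈0)))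
            (lead-* c-lead (lead-* lY lY))))
          where open Admissible gₙ

        lead-case : Admissible L ρ r₀ (a n) (b n) (c n) →
          Admissible L ρ r₀ (a (suc n)) (b (suc n)) (c (suc n)) →
          ∀ {x x₀} → x₀ ≢ 0ℚ → Lead X x x₀ → ⊥
        -- Up to a common factor Y this compares the degrees of c Y² and b X Y. If they differ, the
        -- larger is the degree of v and at least L, which is absurd.
        lead-case gₙ gₙ₊₁ {x} {x₀} x₀≢0 lX with ℤₚ.<-cmp (γ ℤ.+ y) (ρ ℤ.+ x)
          where open Admissible gₙ
        ... | tri< γ+y<ρ+x _ _ = *-≢0 r₀≢0 (*-≢0 x₀≢0 y₀≢0)
          (trans (trans (sym (ℚₚ.+-identityˡ _)) (sym (ℚₚ.+-identityʳ _)))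
            (too-large (ℤₚ.≤-trans (L≤γ+2z L≤γ 0≤y) (ℤₚ.<⇒≤ γ+2y<N)) (lead-cong (≈-sym v≈)
              (value-lead aXX (lead-* b-lead (lead-* lX lY))
                (lead-< (lead-* c-lead (lead-* lY lY)) γ+2y<N)))))
          where
          open Admissible gₙ
          γ+2y<N : γ ℤ.+ (y ℤ.+ y) ℤ.< ρ ℤ.+ (x ℤ.+ y)
          γ+2y<N = subst₂ ℤ._<_ (ℤₚ.+-assoc γ y y) (ℤₚ.+-assoc ρ x y) (ℤₚ.+-monoˡ-< y γ+y<ρ+x)
          aXX : Lead (a n * (X * X)) (ρ ℤ.+ (x ℤ.+ y)) 0ℚ
          aXX = lead-≤ (lead-zeroˡ a-small (lead-* lX lX))
            (ℤₚ.+-monoʳ-≤ ρ (ℤₚ.+-monoʳ-≤ x (x≤y x₀≢0 lX)))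
        ... | tri> _ _ ρ+x<γ+y = *-≢0 c₀≢0 (*-≢0 y₀≢0 y₀≢0)
          (trans (sym (ℚₚ.+-identityˡ _))
            (too-large (L≤γ+2z L≤γ 0≤y) (lead-cong (≈-sym v≈)
              (value-lead aXX (lead-< (lead-* b-lead (lead-* lX lY)) N<γ+2y)
                (lead-* c-lead (lead-* lY lY))))))
          where
          open Admissible gₙ
          N<γ+2y : ρ ℤ.+ (x ℤ.+ y) ℤ.< γ ℤ.+ (y ℤ.+ y)
          N<γ+2y = subst₂ ℤ._<_ (ℤₚ.+-assoc ρ x y) (ℤₚ.+-assoc γ y y) (ℤₚ.+-monoˡ-< y ρ+x<γ+y)
          aXX : Lead (a n * (X * X)) (γ ℤ.+ (y ℤ.+ y)) 0ℚ
          aXX = lead-≤ (lead-zeroˡ a-small (lead-* lX lX))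
            (ℤₚ.≤-trans (ℤₚ.+-monoʳ-≤ ρ (ℤₚ.+-monoʳ-≤ x (x≤y x₀≢0 lX))) (ℤₚ.<⇒≤ N<γ+2y))
        ... | tri≈ _ γ+y≡ρ+x _ =
          descend k (suc n) (polynomial-+ (polynomial-* (δ-polynomial n) pX) (polynomial-neg pY)) pX
            x₀≢0 lX x′≤x (ℤₚ.<-≤-trans x<y (y≤k y<k)) v≈′
          where
          open Admissible gₙ
          open Admissible gₙ₊₁ using ()
            renaming (b-lead to b′-lead; c-lead to c′-lead; γ<ρ to γ′<ρ)
          X′ = δ n * X - Y
          v≈′ : v ≈ ⟪ a (suc n) , b (suc n) , c (suc n) ⟫ X′ X
          v≈′ = ≈-trans v≈ (step-value (step n) X Y)
          y≤k : y ℤ.< + suc k → y ℤ.≤ + k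
          y≤k y<1+k = ℤₚ.≮⇒≥ λ k<y → ℤₚ.<⇒≱ y<1+k (ℤₚ.i<j⇒suc[i]≤j k<y)
          -- As deg c < deg b, the tie forces X to have the smaller degree; this makes the induction
          -- progress.
          x<y : x ℤ.< y
          x<y = ℤₚ.≰⇒> λ y≤x → ℤₚ.<-irrefl γ+y≡ρ+x (ℤₚ.+-mono-<-≤ γ<ρ y≤x)
          N≡γ+2y : γ ℤ.+ (y ℤ.+ y) ≡ ρ ℤ.+ (x ℤ.+ y)
          N≡γ+2y = trans (sym (ℤₚ.+-assoc γ y y)) (trans (cong (ℤ._+ y) γ+y≡ρ+x) (ℤₚ.+-assoc ρ x y))
          cancellation : 0ℚ ℚ.+ r₀ ℚ.* (x₀ ℚ.* y₀) ℚ.+ c₀ ℚ.* (y₀ ℚ.* y₀) ≡ 0ℚ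
          cancellation = too-large (subst (L ℤ.≤_) N≡γ+2y (L≤γ+2z L≤γ 0≤y)) (lead-cong (≈-sym v≈)
            (value-lead
              (lead-≤ (lead-zeroˡ a-small (lead-* lX lX))
                (ℤₚ.+-monoʳ-≤ ρ (ℤₚ.+-monoʳ-≤ x (x≤y x₀≢0 lX))))
              (lead-* b-lead (lead-* lX lY))
              (lead-subst N≡γ+2y refl (lead-* c-lead (lead-* lY lY)))))
          -r₀x₀-c₀y₀≡0 : ℚ.- r₀ ℚ.* x₀ ℚ.+ ℚ.- (c₀ ℚ.* y₀) ≡ 0ℚ
          -r₀x₀-c₀y₀≡0 = decidable-stable (_ ℚₚ.≟ 0ℚ) λ ≢0 →
            *-≢0 ≢0 y₀≢0 (trans (ℚ-identities.tie r₀ c₀ x₀ y₀) (cong ℚ.-_ cancellation))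
          cδ-lead : Lead (c n * δ n) ρ (ℚ.- r₀)
          cδ-lead = lead-subst refl (ℚ-identities.½-neg r₀) (lead-cong (≈-sym (step-product (step n)))
            (lead-scale ½ (lead-+ (lead-neg b-lead) (lead-neg b′-lead))))
          cX′-small : Lead (c n * X′) (ρ ℤ.+ x) 0ℚ
          cX′-small = lead-cong (≈-sym (distribˡ-assoc (c n) (δ n) X Y))
            (lead-subst refl -r₀x₀-c₀y₀≡0 (lead-+ (lead-* cδ-lead lX)
              (lead-neg (lead-subst γ+y≡ρ+x refl (lead-* c-lead lY)))))
          -- If x < x′, then b′ X′ X dominates the next form: a′ X′² is smaller because a′ ≈ c and
          -- deg (c X′) < ρ + x, and c′ X² because deg c′ < ρ.
          x′≤x : ∀ {x′ x′₀} → x′₀ ≢ 0ℚ → Lead X′ x′ x′₀ → x′ ℤ.≤ x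
          x′≤x {x′} {x′₀} x′₀≢0 lX′ = ℤₚ.≮⇒≥ λ x<x′ → *-≢0 r₀≢0 (*-≢0 x′₀≢0 x₀≢0)
            (trans (trans (sym (ℚₚ.+-identityˡ _)) (sym (ℚₚ.+-identityʳ _)))
              (too-large (ℤₚ.≤-trans (L≤γ+2z L≤γ 0≤x′) (ℤₚ.<⇒≤ γ+2x′<N)) (lead-cong (≈-sym v≈′)
                (value-lead
                  (lead-cong (*-cong (≈-sym (a′≈ (step n))) ≈-refl)
                    (lead-< (lead-* c-lead (lead-* lX′ lX′)) γ+2x′<N))
                  (lead-* b′-lead (lead-* lX′ lX))
                  (lead-≤ (lead-zeroˡ (lead-< c′-lead γ′<ρ) (lead-* lX lX))
                    (ℤₚ.+-monoʳ-≤ ρ (ℤₚ.+-monoˡ-≤ x (ℤₚ.<⇒≤ x<x′))))))))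
            where
            0≤x′ = polynomial-degree
              (polynomial-+ (polynomial-* (δ-polynomial n) pX) (polynomial-neg pY)) x′₀≢0 lX′
            γ+x′<ρ+x : γ ℤ.+ x′ ℤ.< ρ ℤ.+ x
            γ+x′<ρ+x = ℤₚ.≰⇒> λ ρ+x≤γ+x′ → *-≢0 c₀≢0 x′₀≢0
              (lead-unique (lead-* c-lead lX′) (lead-≤ cX′-small ρ+x≤γ+x′))
            γ+2x′<N : γ ℤ.+ (x′ ℤ.+ x′) ℤ.< ρ ℤ.+ (x′ ℤ.+ x)
            γ+2x′<N = subst₂ ℤ._<_ (ℤₚ.+-assoc γ x′ x′)
              (trans (ℤₚ.+-assoc ρ x x′) (cong (λ z → ρ ℤ.+ z) (ℤₚ.+-comm x x′)))
              (ℤₚ.+-monoˡ-< x′ γ+x′<ρ+x)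

-- Defs is opened only here because its operators clash with those of the abstract
-- ring above.
open import Defs

-- Power series and the Cauchy product

tail : (ℕ → ℚ) → ℕ → ℚ
tail p k = p (suc k)

-- The sum of all p i q j with i + j = k, peeling off p 0 each time. No subtraction of indices
-- occurs, and the laws below become structural inductions.
conv : (p q : ℕ → ℚ) → ℕ → ℚ
conv p q zero    = p 0 ℚ.* q 0
conv p q (suc k) = p 0 ℚ.* q (suc k) ℚ.+ conv (tail p) q k

conv-cong : ∀ {p p′ q q′} → (∀ k → p k ≡ p′ k) → (∀ k → q k ≡ q′ k) →
            ∀ k → conv p q k ≡ conv p′ q′ k
conv-cong p≗ q≗ zero    = cong₂ ℚ._*_ (p≗ 0) (q≗ 0)
conv-cong p≗ q≗ (suc k) = cong₂ ℚ._+_ (cong₂ ℚ._*_ (p≗ 0) (q≗ (suc k)))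
  (conv-cong (λ j → p≗ (suc j)) q≗ k)

-- Peels the sum from its other end; commutativity compares the two peelings.
conv-sucʳ : ∀ p q k → conv p q (suc k) ≡ conv p (tail q) k ℚ.+ p (suc k) ℚ.* q 0
conv-sucʳ p q zero    = refl
conv-sucʳ p q (suc k) = trans
  (cong (p 0 ℚ.* q (suc (suc k)) ℚ.+_) (conv-sucʳ (tail p) q k))
  (sym (ℚₚ.+-assoc (p 0 ℚ.* q (suc (suc k))) _ _))

conv-comm : ∀ p q k → conv p q k ≡ conv q p k
conv-comm p q zero    = ℚₚ.*-comm (p 0) (q 0)
conv-comm p q (suc k) = begin
  p 0 ℚ.* q (suc k) ℚ.+ conv (tail p) q k
    ≡⟨ cong₂ ℚ._+_ (ℚₚ.*-comm (p 0) (q (suc k))) (conv-comm (tail p) q k) ⟩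
  q (suc k) ℚ.* p 0 ℚ.+ conv q (tail p) k
    ≡⟨ ℚₚ.+-comm (q (suc k) ℚ.* p 0) _ ⟩
  conv q (tail p) k ℚ.+ q (suc k) ℚ.* p 0
    ≡⟨ conv-sucʳ q p k ⟨
  conv q p (suc k) ∎
  where open ≡-Reasoning

conv-distribʳ : ∀ p q r k →
                conv (λ j → p j ℚ.+ q j) r k ≡ conv p r k ℚ.+ conv q r k
conv-distribʳ p q r zero    = ℚₚ.*-distribʳ-+ (r 0) (p 0) (q 0)
conv-distribʳ p q r (suc k) = trans
  (cong ((p 0 ℚ.+ q 0) ℚ.* r (suc k) ℚ.+_) (conv-distribʳ (tail p) (tail q) r k))
  (rearrange (p 0) (q 0) (r (suc k)) _ _)
  where
  rearrange : ∀ a b c x y →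
    (a ℚ.+ b) ℚ.* c ℚ.+ (x ℚ.+ y) ≡ (a ℚ.* c ℚ.+ x) ℚ.+ (b ℚ.* c ℚ.+ y)
  rearrange = solve 5 (λ a b c x y → (a :+ b) :* c :+ (x :+ y) := (a :* c :+ x) :+ (b :* c :+ y)) refl
    where open +-*-Solver

conv-scale : ∀ c p q k → conv (λ j → c ℚ.* p j) q k ≡ c ℚ.* conv p q k
conv-scale c p q zero    = ℚₚ.*-assoc c (p 0) (q 0)
conv-scale c p q (suc k) = trans
  (cong (c ℚ.* p 0 ℚ.* q (suc k) ℚ.+_) (conv-scale c (tail p) q k))
  (rearrange c (p 0) (q (suc k)) _)
  where
  rearrange : ∀ c a b x → c ℚ.* a ℚ.* b ℚ.+ c ℚ.* x ≡ c ℚ.* (a ℚ.* b ℚ.+ x)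
  rearrange = solve 4 (λ c a b x → c :* a :* b :+ c :* x := c :* (a :* b :+ x)) refl
    where open +-*-Solver

-- By definition, the tail of `conv p q` is p 0 times the tail of q plus `conv (tail p) q`, so
-- linearity in the first argument reduces the claim to `tail p`.
conv-assoc : ∀ p q r k → conv (conv p q) r k ≡ conv p (conv q r) k
conv-assoc p q r zero    = ℚₚ.*-assoc (p 0) (q 0) (r 0)
conv-assoc p q r (suc k) = begin
  p 0 ℚ.* q 0 ℚ.* r (suc k) ℚ.+
    conv (λ j → p 0 ℚ.* tail q j ℚ.+ conv (tail p) q j) r k
    ≡⟨ cong (p 0 ℚ.* q 0 ℚ.* r (suc k) ℚ.+_)
         (conv-distribʳ (λ j → p 0 ℚ.* tail q j) (conv (tail p) q) r k) ⟩
  p 0 ℚ.* q 0 ℚ.* r (suc k) ℚ.+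
    (conv (λ j → p 0 ℚ.* tail q j) r k ℚ.+ conv (conv (tail p) q) r k)
    ≡⟨ cong (p 0 ℚ.* q 0 ℚ.* r (suc k) ℚ.+_)
         (cong₂ ℚ._+_ (conv-scale (p 0) (tail q) r k) (conv-assoc (tail p) q r k)) ⟩
  p 0 ℚ.* q 0 ℚ.* r (suc k) ℚ.+
    (p 0 ℚ.* conv (tail q) r k ℚ.+ conv (tail p) (conv q r) k)
    ≡⟨ rearrange (p 0) (q 0) (r (suc k)) _ _ ⟩
  p 0 ℚ.* (q 0 ℚ.* r (suc k) ℚ.+ conv (tail q) r k) ℚ.+ conv (tail p) (conv q r) k ∎
  where
  open ≡-Reasoning
  rearrange : ∀ a b c x y →
    a ℚ.* b ℚ.* c ℚ.+ (a ℚ.* x ℚ.+ y) ≡ a ℚ.* (b ℚ.* c ℚ.+ x) ℚ.+ y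
  rearrange = solve 5 (λ a b c x y → a :* b :* c :+ (a :* x :+ y) := a :* (b :* c :+ x) :+ y) refl
    where open +-*-Solver

conv-zero : ∀ {p q} N → (∀ i j → i ℕ.+ j ≡ N → p i ≡ 0ℚ ⊎ q j ≡ 0ℚ) → conv p q N ≡ 0ℚ
conv-zero {p} {q} zero    zeros = *-≡0 (zeros 0 0 refl)
conv-zero {p} {q} (suc N) zeros = trans
  (cong₂ ℚ._+_ (*-≡0 (zeros 0 (suc N) refl))
    (conv-zero N λ i j i+j≡N → zeros (suc i) j (cong suc i+j≡N)))
  (ℚₚ.+-identityˡ 0ℚ)

-- Asking for the terms only at i + j ≡ N keeps truncated subtraction out of the induction.
sum≡conv : ∀ (t : ℕ → ℚ) p q N → (∀ i j → i ℕ.+ j ≡ N → t i ≡ p i ℚ.* q j) →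
           ∑[ k < suc N ] t (toℕ k) ≡ conv p q N
sum≡conv t p q zero    t≡ = trans (ℚₚ.+-identityʳ (t 0)) (t≡ 0 0 refl)
sum≡conv t p q (suc N) t≡ = cong₂ ℚ._+_ (t≡ 0 (suc N) refl)
  (sum≡conv (tail t) (tail p) q N λ i j i+j≡N → t≡ (suc i) j (cong suc i+j≡N))

-- Laurent series as shifted power series

-- The power series in 1/T that remains after the factor T to the power `bound x` is taken out. In a
-- product the bounds add and the digits convolve.
digits : ℚ⟨⟨1/T⟩⟩ → ℕ → ℚ
digits x k = coeff x (bound x ℤ.- + k)

below-or-above : ∀ b n → (∃[ k ] n ≡ b ℤ.- + k) ⊎ b ℤ.< n
below-or-above b n with b ℤₚ.<? n
... | yes b<n = inj₂ b<n
... | no  b≮n = inj₁ (∣ b ℤ.- n ∣ ,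
  trans (cancel b n) (cong (λ z → b ℤ.- z)
    (sym (ℤₚ.0≤i⇒+∣i∣≡i (ℤₚ.i≤j⇒0≤j-i (ℤₚ.≮⇒≥ b≮n))))))
  where
  cancel : ∀ b n → n ≡ b ℤ.- (b ℤ.- n)
  cancel = ℤ-Solver.solve-∀

ext : ∀ x y → bound x ≡ bound y → (∀ k → digits x k ≡ digits y k) → x ≈ y
ext x y bx≡by x≗y n with below-or-above (bound x) n
... | inj₁ (k , refl) = trans (x≗y k) (cong (λ b → coeff y (b ℤ.- + k)) (sym bx≡by))
... | inj₂ b<n = trans (vanishes x n b<n) (sym (vanishes y n (subst (ℤ._< n) bx≡by b<n)))

digits-* : ∀ x y k → digits (x * y) k ≡ conv (digits x) (digits y) k
digits-* x y k = trans
  (cong (λ l → ∑[ i < suc l ] cauchyTerm x y n (toℕ i)) length≡)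
  (sum≡conv (cauchyTerm x y n) (digits x) (digits y) k term≡)
  where
  n = bound x ℤ.+ bound y ℤ.- + k
  cancel : ∀ b k → b ℤ.- (b ℤ.- k) ≡ k
  cancel = ℤ-Solver.solve-∀
  length≡ : ∣ bound x ℤ.+ bound y ℤ.- n ∣ ≡ k
  length≡ = cong ∣_∣ (cancel (bound x ℤ.+ bound y) (+ k))
  index : ∀ a b i j → a ℤ.+ b ℤ.- (i ℤ.+ j) ℤ.- (a ℤ.- i) ≡ b ℤ.- j
  index = ℤ-Solver.solve-∀
  term≡ : ∀ i j → i ℕ.+ j ≡ k → cauchyTerm x y n i ≡ digits x i ℚ.* digits y j
  term≡ i j refl = cong (λ m → digits x i ℚ.* coeff y m)
    (index (bound x) (bound y) (+ i) (+ j))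

-- The ring of Laurent series

≈-refl : ∀ {x} → x ≈ x
≈-refl n = refl

≈-sym : ∀ {x y} → x ≈ y → y ≈ x
≈-sym x≈y n = sym (x≈y n)

≈-trans : ∀ {x y z} → x ≈ y → y ≈ z → x ≈ z
≈-trans x≈y y≈z n = trans (x≈y n) (y≈z n)

*-comm : ∀ x y → x * y ≈ y * x
*-comm x y = ext (x * y) (y * x) (ℤₚ.+-comm (bound x) (bound y)) λ k →
  trans (digits-* x y k)
    (trans (conv-comm (digits x) (digits y) k) (sym (digits-* y x k)))

*-assoc : ∀ x y z → (x * y) * z ≈ x * (y * z)
*-assoc x y z = ext ((x * y) * z) (x * (y * z))
  (ℤₚ.+-assoc (bound x) (bound y) (bound z)) λ k → begin
  digits ((x * y) * z) k                         ≡⟨ digits-* (x * y) z k ⟩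
  conv (digits (x * y)) (digits z) k
    ≡⟨ conv-cong (digits-* x y) (λ _ → refl) k ⟩
  conv (conv (digits x) (digits y)) (digits z) k
    ≡⟨ conv-assoc (digits x) (digits y) (digits z) k ⟩
  conv (digits x) (conv (digits y) (digits z)) k
    ≡⟨ conv-cong {p = digits x} (λ _ → refl) (λ j → sym (digits-* y z j)) k ⟩
  conv (digits x) (digits (y * z)) k             ≡⟨ digits-* x (y * z) k ⟨
  digits (x * (y * z)) k ∎
  where open ≡-Reasoning

-- The Cauchy product depends on the bounds of its factors, so well-definedness
-- is a statement about changing them.
rebound : ∀ x b → (∀ n → b ℤ.< n → coeff x n ≡ 0ℚ) → ℚ⟨⟨1/T⟩⟩
rebound x b x≡0 = record { coeff = coeff x ; bound = b ; vanishes = x≡0 }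

i<suc[i] : ∀ i → i ℤ.< ℤ.suc i
i<suc[i] i = ℤₚ.suc[i]≤j⇒i<j ℤₚ.≤-refl

-- Raising the bound one unit at a time prepends a single zero digit, which matches one unfolding of
-- `conv`.
raise : ℕ → ℚ⟨⟨1/T⟩⟩ → ℚ⟨⟨1/T⟩⟩
raise zero    x = x
raise (suc j) x = rebound (raise j x) (ℤ.suc (bound (raise j x)))
  λ n b<n → vanishes (raise j x) n (ℤₚ.<-trans (i<suc[i] _) b<n)

raise-≈ : ∀ j x → raise j x ≈ x
raise-≈ zero    x n = refl
raise-≈ (suc j) x n = raise-≈ j x n

bound-raise : ∀ j x → bound (raise j x) ≡ + j ℤ.+ bound x
bound-raise zero    x = sym (ℤₚ.+-identityˡ (bound x))
bound-raise (suc j) x = trans (cong ℤ.suc (bound-raise j x)) (sym (ℤₚ.+-assoc 1ℤ (+ j) (bound x)))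

raise-to : ∀ x b → bound x ℤ.≤ b → ∃[ j ] bound (raise j x) ≡ b
raise-to x b bx≤b = ∣ b ℤ.- bound x ∣ ,
  trans (bound-raise ∣ b ℤ.- bound x ∣ x)
    (trans (cong (ℤ._+ bound x) (ℤₚ.0≤i⇒+∣i∣≡i (ℤₚ.i≤j⇒0≤j-i bx≤b)))
      (cancel b (bound x)))
  where
  cancel : ∀ b c → b ℤ.- c ℤ.+ c ≡ b
  cancel = ℤ-Solver.solve-∀

raise-*ˡ : ∀ j x y → raise j x * y ≈ x * y
raise-*ˡ zero    x y = ≈-refl {x * y}
raise-*ˡ (suc j) x y = ≈-trans {raise (suc j) x * y} {raise 1 (x′ * y)} {x * y}
  (ext (raise (suc j) x * y) (raise 1 (x′ * y)) (ℤₚ.+-assoc 1ℤ (bound x′) (bound y)) shift)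
  (raise-*ˡ j x y)
  where
  x′ = raise j x
  suc-shift : ∀ b k → ℤ.suc b ℤ.- + suc k ≡ b ℤ.- + k
  suc-shift b k = cancel b (+ k)
    where
    cancel : ∀ b k → 1ℤ ℤ.+ b ℤ.- (1ℤ ℤ.+ k) ≡ b ℤ.- k
    cancel = ℤ-Solver.solve-∀
  digit0 : ∀ z → digits (raise 1 z) 0 ≡ 0ℚ
  digit0 z = vanishes z (ℤ.suc (bound z) ℤ.- 0ℤ)
    (subst (bound z ℤ.<_) (sym (ℤₚ.+-identityʳ _)) (i<suc[i] (bound z)))
  shift : ∀ k → digits (raise (suc j) x * y) k ≡ digits (raise 1 (x′ * y)) k
  shift zero = trans (digits-* (raise (suc j) x) y 0)
    (trans (cong (ℚ._* digits y 0) (digit0 x′))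
      (trans (ℚₚ.*-zeroˡ (digits y 0)) (sym (digit0 (x′ * y)))))
  shift (suc k) = begin
    digits (raise (suc j) x * y) (suc k)
      ≡⟨ digits-* (raise (suc j) x) y (suc k) ⟩
    digits (raise 1 x′) 0 ℚ.* digits y (suc k) ℚ.+ conv (tail (digits (raise 1 x′))) (digits y) k
      ≡⟨ cong₂ ℚ._+_
           (trans (cong (ℚ._* digits y (suc k)) (digit0 x′)) (ℚₚ.*-zeroˡ (digits y (suc k))))
           (conv-cong (λ i → cong (coeff x′) (suc-shift (bound x′) i)) (λ _ → refl) k) ⟩
    0ℚ ℚ.+ conv (digits x′) (digits y) k ≡⟨ ℚₚ.+-identityˡ _ ⟩
    conv (digits x′) (digits y) k        ≡⟨ digits-* x′ y k ⟨
    digits (x′ * y) k                    ≡⟨ cong (coeff (x′ * y)) (suc-shift (bound (x′ * y)) k) ⟨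
    digits (raise 1 (x′ * y)) (suc k) ∎
    where open ≡-Reasoning

*-congʳ-≡bound : ∀ {x x′} y → bound x ≡ bound x′ → x ≈ x′ → x * y ≈ x′ * y
*-congʳ-≡bound {x} {x′} y b≡b′ x≈x′ = ext (x * y) (x′ * y) (cong (ℤ._+ bound y) b≡b′) λ k →
  trans (digits-* x y k) (trans
    (conv-cong (λ j → trans (x≈x′ _) (cong (λ b → coeff x′ (b ℤ.- + j)) b≡b′)) (λ _ → refl) k)
    (sym (digits-* x′ y k)))

-- Both factors are raised to the larger of their bounds; there equal series have equal digits.
*-congʳ : ∀ {x x′} y → x ≈ x′ → x * y ≈ x′ * y
*-congʳ {x} {x′} y x≈x′
  with raise-to x (bound x ℤ.⊔ bound x′) (ℤₚ.i≤i⊔j (bound x) (bound x′))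
     | raise-to x′ (bound x ℤ.⊔ bound x′) (ℤₚ.i≤j⊔i (bound x) (bound x′))
... | j , bj≡ | j′ , bj′≡ = ≈-trans {x * y} {raise j x * y} {x′ * y}
  (≈-sym {raise j x * y} {x * y} (raise-*ˡ j x y))
  (≈-trans {raise j x * y} {raise j′ x′ * y} {x′ * y}
    (*-congʳ-≡bound {raise j x} {raise j′ x′} y (trans bj≡ (sym bj′≡)) λ n →
      trans (raise-≈ j x n) (trans (x≈x′ n) (sym (raise-≈ j′ x′ n))))
    (raise-*ˡ j′ x′ y))

*-cong : ∀ {x x′ y y′} → x ≈ x′ → y ≈ y′ → x * y ≈ x′ * y′
*-cong {x} {x′} {y} {y′} x≈x′ y≈y′ n = trans (*-congʳ {x} {x′} y x≈x′ n)
  (trans (*-comm x′ y n) (trans (*-congʳ {y} {y′} x′ y≈y′ n) (*-comm y′ x′ n)))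

*-distribʳ : ∀ z x y → (x + y) * z ≈ x * z + y * z
*-distribʳ z x y n = trans (*-congʳ {x + y} {x′ + y′} z (λ _ → refl) n)
  (trans (ext ((x′ + y′) * z) (x′ * z + y′ * z) bound≡ digits≡ n)
    (cong₂ ℚ._+_ (*-congʳ {x′} {x} z (λ _ → refl) n) (*-congʳ {y′} {y} z (λ _ → refl) n)))
  where
  -- With a common bound the digits of the sum are the sums of the digits, up to idempotence of the
  -- maximum.
  M = bound x ℤ.⊔ bound y
  x′ = rebound x M λ n M<n → vanishes x n (ℤₚ.≤-<-trans (ℤₚ.i≤i⊔j (bound x) (bound y)) M<n)
  y′ = rebound y M λ n M<n → vanishes y n (ℤₚ.≤-<-trans (ℤₚ.i≤j⊔i (bound x) (bound y)) M<n)
  bound≡ : (M ℤ.⊔ M) ℤ.+ bound z ≡ (M ℤ.+ bound z) ℤ.⊔ (M ℤ.+ bound z)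
  bound≡ = trans (cong (ℤ._+ bound z) (ℤₚ.⊔-idem M)) (sym (ℤₚ.⊔-idem (M ℤ.+ bound z)))
  idem : ∀ w k → coeff w (bound w ℤ.⊔ bound w ℤ.- + k) ≡ digits w k
  idem w k = cong (λ c → coeff w (c ℤ.- + k)) (ℤₚ.⊔-idem (bound w))
  digits≡ : ∀ k → digits ((x′ + y′) * z) k ≡ digits (x′ * z + y′ * z) k
  digits≡ k = begin
    digits ((x′ + y′) * z) k ≡⟨ digits-* (x′ + y′) z k ⟩
    conv (digits (x′ + y′)) (digits z) k
      ≡⟨ conv-cong (λ j → cong₂ ℚ._+_ (idem x′ j) (idem y′ j)) (λ _ → refl) k ⟩
    conv (λ j → digits x′ j ℚ.+ digits y′ j) (digits z) k
      ≡⟨ conv-distribʳ (digits x′) (digits y′) (digits z) k ⟩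
    conv (digits x′) (digits z) k ℚ.+ conv (digits y′) (digits z) k
      ≡⟨ cong₂ ℚ._+_ (digits-* x′ z k) (digits-* y′ z k) ⟨
    digits (x′ * z) k ℚ.+ digits (y′ * z) k
      ≡⟨ cong₂ ℚ._+_ (idem (x′ * z) k) (idem (y′ * z) k) ⟨
    digits (x′ * z + y′ * z) k ∎
    where open ≡-Reasoning

const-*-coeff : ∀ q x n → coeff (const q * x) n ≡ q ℚ.* coeff x n
const-*-coeff q x n with below-or-above (bound x) n
... | inj₂ b<n = trans (vanishes (const q * x) n (subst (ℤ._< n) (sym (ℤₚ.+-identityˡ (bound x))) b<n))
  (sym (trans (cong (q ℚ.*_) (vanishes x n b<n)) (ℚₚ.*-zeroʳ q)))
... | inj₁ (k , refl) = trans
  (cong (λ b → coeff (const q * x) (b ℤ.- + k)) (sym (ℤₚ.+-identityˡ (bound x))))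
  (trans (digits-* (const q) x k) (conv-const k))
  where
  conv-const : ∀ k → conv (digits (const q)) (digits x) k ≡ q ℚ.* digits x k
  conv-const zero    = refl
  conv-const (suc k) = trans
    (cong (q ℚ.* digits x (suc k) ℚ.+_) (conv-zero {tail (digits (const q))} {digits x} k λ _ _ _ → inj₁ refl))
    (ℚₚ.+-identityʳ (q ℚ.* digits x (suc k)))

const-+ : ∀ p q → const (p ℚ.+ q) ≈ const p + const q
const-+ p q +0       = refl
const-+ p q +[1+ n ] = refl
const-+ p q -[1+ n ] = refl

const-neg : ∀ p → const (ℚ.- p) ≈ - const p
const-neg p +0       = refl
const-neg p +[1+ n ] = refl
const-neg p -[1+ n ] = refl

const-* : ∀ p q → const (p ℚ.* q) ≈ const p * const q
const-* p q n = trans (scale n) (sym (const-*-coeff p (const q) n))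
  where
  scale : ∀ n → coeff (const (p ℚ.* q)) n ≡ p ℚ.* coeff (const q) n
  scale +0       = refl
  scale +[1+ n ] = sym (ℚₚ.*-zeroʳ p)
  scale -[1+ n ] = sym (ℚₚ.*-zeroʳ p)

coeff-0# : ∀ n → coeff 0# n ≡ 0ℚ
coeff-0# +0       = refl
coeff-0# +[1+ n ] = refl
coeff-0# -[1+ n ] = refl

commutativeRing : CommutativeRing 0ℓ 0ℓ
commutativeRing = record
  { Carrier = ℚ⟨⟨1/T⟩⟩
  ; _≈_ = _≈_
  ; _+_ = _+_
  ; _*_ = _*_
  ; -_  = -_
  ; 0#  = 0#
  ; 1#  = 1#
  ; isCommutativeRing = record
    { isRing = record
      { +-isAbelianGroup = record
        { isGroup = record
          { isMonoid = record
            { isSemigroup = record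
              { isMagma = record
                { isEquivalence = record
                  { refl  = λ {x} → ≈-refl {x}
                  ; sym   = λ {x} {y} → ≈-sym {x} {y}
                  ; trans = λ {x} {y} {z} → ≈-trans {x} {y} {z}
                  }
                ; ∙-cong = λ x≈x′ y≈y′ n → cong₂ ℚ._+_ (x≈x′ n) (y≈y′ n)
                }
              ; assoc = λ x y z n → ℚₚ.+-assoc (coeff x n) (coeff y n) (coeff z n)
              }
            ; identity =
                (λ x n → trans (cong (ℚ._+ coeff x n) (coeff-0# n)) (ℚₚ.+-identityˡ (coeff x n)))
              , (λ x n → trans (cong (coeff x n ℚ.+_) (coeff-0# n)) (ℚₚ.+-identityʳ (coeff x n)))
            }
          ; inverse =
              (λ x n → trans (ℚₚ.+-inverseˡ (coeff x n)) (sym (coeff-0# n)))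
            , (λ x n → trans (ℚₚ.+-inverseʳ (coeff x n)) (sym (coeff-0# n)))
          ; ⁻¹-cong = λ x≈y n → cong ℚ.-_ (x≈y n)
          }
        ; comm = λ x y n → ℚₚ.+-comm (coeff x n) (coeff y n)
        }
      ; *-cong = λ {x} {x′} {y} {y′} → *-cong {x} {x′} {y} {y′}
      ; *-assoc = *-assoc
      ; *-identity = *-identityˡ , λ x n → trans (*-comm x 1# n) (*-identityˡ x n)
      ; distrib =
          (λ z x y n → trans (*-comm z (x + y) n)
            (trans (*-distribʳ z x y n) (cong₂ ℚ._+_ (*-comm x z n) (*-comm y z n))))
        , *-distribʳ
      }
    ; *-comm = *-comm
    }
  }
  where
  *-identityˡ : ∀ x → 1# * x ≈ x
  *-identityˡ x n = trans (const-*-coeff 1ℚ x n) (ℚₚ.*-identityˡ (coeff x n))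

-- Degrees

Lead : ℚ⟨⟨1/T⟩⟩ → ℤ → ℚ → Set
Lead x n c = coeff x n ≡ c × (∀ m → n ℤ.< m → coeff x m ≡ 0ℚ)

lead-cong : ∀ {x y n c} → x ≈ y → Lead x n c → Lead y n c
lead-cong x≈y (xₙ≡c , x≡0) =
  trans (sym (x≈y _)) xₙ≡c , λ m n<m → trans (sym (x≈y m)) (x≡0 m n<m)

lead-+ : ∀ {x y n c d} → Lead x n c → Lead y n d → Lead (x + y) n (c ℚ.+ d)
lead-+ (xₙ≡c , x≡0) (yₙ≡d , y≡0) =
  cong₂ ℚ._+_ xₙ≡c yₙ≡d , λ m n<m → cong₂ ℚ._+_ (x≡0 m n<m) (y≡0 m n<m)

-- Lowering or raising the bounds to m and n makes the leading coefficients the digits at 0, where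
-- `conv` is a single product.
lead-* : ∀ {x y m n c d} → Lead x m c → Lead y n d → Lead (x * y) (m ℤ.+ n) (c ℚ.* d)
lead-* {x} {y} {m} {n} {c} {d} (xₘ≡c , x≡0) (yₙ≡d , y≡0) =
  lead-cong {x′ * y′} {x * y} (*-cong {x′} {x} {y′} {y} (λ _ → refl) (λ _ → refl))
    ( trans (cong (coeff (x′ * y′)) (sym (ℤₚ.+-identityʳ (m ℤ.+ n))))
        (trans (digits-* x′ y′ 0) (cong₂ ℚ._*_
          (trans (cong (coeff x) (ℤₚ.+-identityʳ m)) xₘ≡c)
          (trans (cong (coeff y) (ℤₚ.+-identityʳ n)) yₙ≡d)))
    , vanishes (x′ * y′))
  where
  x′ = rebound x m x≡0
  y′ = rebound y n y≡0

lead-< : ∀ {x m n c} → Lead x m c → m ℤ.< n → Lead x n 0ℚ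
lead-< (_ , x≡0) m<n = x≡0 _ m<n , λ k n<k → x≡0 k (ℤₚ.<-trans m<n n<k)

lead-neg : ∀ {x n c} → Lead x n c → Lead (- x) n (ℚ.- c)
lead-neg (xₙ≡c , x≡0) = cong ℚ.-_ xₙ≡c , λ m n<m → cong ℚ.-_ (x≡0 m n<m)

lead-unique : ∀ {x n c d} → Lead x n c → Lead x n d → c ≡ d
lead-unique (xₙ≡c , _) (xₙ≡d , _) = trans (sym xₙ≡c) xₙ≡d

lead-const : ∀ q → Lead (const q) 0ℤ q
lead-const q = refl , vanishes (const q)

-- Downward induction from the bound: once everything above n vanishes, a nonzero coefficient at n
-- would be a leading one, and equality in ℚ is decidable.
¬lead⇒≈0 : ∀ x → ¬ (∃[ n ] ∃[ c ] c ≢ 0ℚ × Lead x n c) → x ≈ 0#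
¬lead⇒≈0 x none n = trans (x≡0 n) (sym (coeff-0# n))
  where
  coeff≡0 : ∀ n → (∀ m → n ℤ.< m → coeff x m ≡ 0ℚ) → coeff x n ≡ 0ℚ
  coeff≡0 n above with coeff x n ℚₚ.≟ 0ℚ
  ... | yes xₙ≡0 = xₙ≡0
  ... | no  xₙ≢0 = ⊥-elim (none (n , coeff x n , xₙ≢0 , refl , above))
  descend : ∀ k m → bound x ℤ.- + k ℤ.< m → coeff x m ≡ 0ℚ
  descend zero    m b<m = vanishes x m (subst (ℤ._< m) (ℤₚ.+-identityʳ (bound x)) b<m)
  descend (suc k) m b<m with bound x ℤ.- + k ℤₚ.<? m
  ... | yes b-k<m = descend k m b-k<m
  ... | no  b-k≮m = subst (λ m → coeff x m ≡ 0ℚ) (sym m≡b-k)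
                      (coeff≡0 (bound x ℤ.- + k) (descend k))
    where
    step : ∀ b k → 1ℤ ℤ.+ (b ℤ.- (1ℤ ℤ.+ k)) ≡ b ℤ.- k
    step = ℤ-Solver.solve-∀
    m≡b-k : m ≡ bound x ℤ.- + k
    m≡b-k = ℤₚ.≤-antisym (ℤₚ.≮⇒≥ b-k≮m)
      (subst (ℤ._≤ m) (step (bound x) (+ k)) (ℤₚ.i<j⇒suc[i]≤j b<m))
  x≡0 : ∀ n → coeff x n ≡ 0ℚ
  x≡0 n with below-or-above (bound x) n
  ... | inj₁ (k , refl) = coeff≡0 _ (descend k)
  ... | inj₂ b<n = vanishes x n b<n

-- Polynomials

Polynomial : ℚ⟨⟨1/T⟩⟩ → Set
Polynomial x = ∀ n → n ℤ.< 0ℤ → coeff x n ≡ 0ℚ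

polynomial-+ : ∀ {x y} → Polynomial x → Polynomial y → Polynomial (x + y)
polynomial-+ px py n n<0 = cong₂ ℚ._+_ (px n n<0) (py n n<0)

polynomial-neg : ∀ {x} → Polynomial x → Polynomial (- x)
polynomial-neg px n n<0 = cong ℚ.-_ (px n n<0)

-- If two exponents have a negative sum, one of them is negative, so every summand of the
-- coefficient vanishes.
polynomial-* : ∀ {x y} → Polynomial x → Polynomial y → Polynomial (x * y)
polynomial-* {x} {y} px py n n<0 with below-or-above (bound x ℤ.+ bound y) n
... | inj₂ b<n = vanishes (x * y) n b<n
... | inj₁ (k , refl) = trans (digits-* x y k) (conv-zero k zeros)
  where
  split : ∀ a b i j → (a ℤ.- i) ℤ.+ (b ℤ.- j) ≡ a ℤ.+ b ℤ.- (i ℤ.+ j)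
  split = ℤ-Solver.solve-∀
  zeros : ∀ i j → i ℕ.+ j ≡ k → digits x i ≡ 0ℚ ⊎ digits y j ≡ 0ℚ
  zeros i j refl with bound x ℤ.- + i ℤₚ.<? 0ℤ | bound y ℤ.- + j ℤₚ.<? 0ℤ
  ... | yes i<0 | _       = inj₁ (px _ i<0)
  ... | no  _   | yes j<0 = inj₂ (py _ j<0)
  ... | no  i≮0 | no  j≮0 = ⊥-elim (ℤₚ.<⇒≱ n<0 (subst (0ℤ ℤ.≤_)
    (split (bound x) (bound y) (+ i) (+ j)) (ℤₚ.+-mono-≤ (ℤₚ.≮⇒≥ i≮0) (ℤₚ.≮⇒≥ j≮0))))

polynomial-degree : ∀ {x n c} → Polynomial x → c ≢ 0ℚ → Lead x n c → 0ℤ ℤ.≤ n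
polynomial-degree px c≢0 (xₙ≡c , _) =
  ℤₚ.≮⇒≥ λ n<0 → c≢0 (trans (sym xₙ≡c) (px _ n<0))

-- Forms and degrees over Laurent series

open CommutativeRing commutativeRing using (ring; +-cong; +-identityˡ; zeroʳ; *-identityˡ)
open RingProperties ring using (-1*x≈-x; -‿involutive)

const-homo : ℚₚ.+-*-rawRing -Raw-AlmostCommutative⟶ fromCommutativeRing commutativeRing
const-homo = record
  { ⟦_⟧    = const
  ; +-homo = const-+
  ; *-homo = const-*
  ; -‿homo = const-neg
  ; 0-homo = λ _ → refl
  ; 1-homo = λ _ → refl
  }

open QuadraticForms commutativeRing const-homo
  using (⟪⟫-cong; transform-value; solve-X; solve-Y; image≈0⇒≈0; Step; reverse;
         transform⇒step; det-step; swap-value; value-at-⟨1,0⟩; module Descent)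

open Descent Lead
  (λ {x} {y} → lead-cong {x} {y})
  (λ {x} {y} → lead-+ {x} {y})
  (λ {x} → lead-neg {x})
  (λ {x} {y} → lead-* {x} {y})
  (λ {x} → lead-< {x})
  (λ {x} → lead-unique {x})
  lead-const ¬lead⇒≈0
  Polynomial
  (λ {x} {y} → polynomial-+ {x} {y})
  (λ {x} → polynomial-neg {x})
  (λ {x} {y} → polynomial-* {x} {y})
  (λ {x} → polynomial-degree {x})
  using (degree-unique; ≈0⇒¬lead; ¬¬zero-or-lead; reduced-lead; Admissible; descend)

infixl 6 _+ₚ_ _-ₚ_
infixl 7 _*ₚ_

_+ₚ_ _-ₚ_ _*ₚ_ : ℚ[T] → ℚ[T] → ℚ[T]
p +ₚ q = record
  { series     = series p + series q
  ; polynomial = polynomial-+ {series p} {series q} (polynomial p) (polynomial q)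
  }
p -ₚ q = record
  { series     = series p - series q
  ; polynomial = polynomial-+ {series p} { - series q} (polynomial p)
                   (polynomial-neg {series q} (polynomial q))
  }
p *ₚ q = record
  { series     = series p * series q
  ; polynomial = polynomial-* {series p} {series q} (polynomial p) (polynomial q)
  }

hasDegree-cong : ∀ {x y d} → x ≈ y → HasDegree x d → HasDegree y d
hasDegree-cong x≈y (isZero x≈0) = isZero λ n → trans (sym (x≈y n)) (x≈0 n)
hasDegree-cong x≈y (leading {n} xₙ≢0 x≡0) =
  leading (λ yₙ≡0 → xₙ≢0 (trans (x≈y n) yₙ≡0)) λ m n<m → trans (sym (x≈y m)) (x≡0 m n<m)

hasDegree-neg : ∀ {x d} → HasDegree x d → HasDegree (- x) d
hasDegree-neg (isZero x≈0) = isZero λ n →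
  trans (cong ℚ.-_ (trans (x≈0 n) (coeff-0# n))) (sym (coeff-0# n))
hasDegree-neg (leading xₙ≢0 x≡0) =
  leading (-‿≢0 xₙ≢0) λ m n<m → cong ℚ.-_ (x≡0 m n<m)

lead⇒hasDegree : ∀ {x n c} → c ≢ 0ℚ → Lead x n c → HasDegree x [ n ]
lead⇒hasDegree c≢0 (xₙ≡c , x≡0) = leading (λ xₙ≡0 → c≢0 (trans (sym xₙ≡c) xₙ≡0)) x≡0

-1^-cases : ∀ i → -1^ i ≡ 1# ⊎ -1^ i ≡ - 1#
-1^-cases i with parity ∣ i ∣
... | 0ℙ = inj₁ refl
... | 1ℙ = inj₂ refl

hasDegree-sign : ∀ i x {d} → HasDegree (-1^ i * x) d ⇔ HasDegree x d
hasDegree-sign i x with -1^ i | -1^-cases i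
... | _ | inj₁ refl = mk⇔
  (hasDegree-cong {1# * x} {x} (*-identityˡ x))
  (hasDegree-cong {x} {1# * x} (λ n → sym (*-identityˡ x n)))
... | _ | inj₂ refl = mk⇔
  (λ h → hasDegree-cong { - (- 1# * x)} {x}
    (λ n → trans (cong ℚ.-_ (-1*x≈-x x n)) (-‿involutive x n))
    (hasDegree-neg { - 1# * x} h))
  (λ h → hasDegree-cong { - x} { - 1# * x} (λ n → sym (-1*x≈-x x n)) (hasDegree-neg {x} h))

-- Equivalent forms

combination≈0 : ∀ p q {u v} → u ≈ 0# → v ≈ 0# → p * u + q * v ≈ 0#
combination≈0 p q {u} {v} u≈0 v≈0 = ≈-trans {p * u + q * v} {0# + 0#} {0#}
  (+-cong {p * u} {0#} {q * v} {0#} (vanish p u u≈0) (vanish q v v≈0)) (+-identityˡ 0#)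
  where
  vanish : ∀ p u → u ≈ 0# → p * u ≈ 0#
  vanish p u u≈0 = ≈-trans {p * u} {p * 0#} {0#}
    (*-cong {p} {p} {u} {0#} (≈-refl {p}) u≈0) (zeroʳ p)

-- A matrix of determinant 1 permutes the nonzero pairs of polynomials; `from` applies it and `to`
-- applies its adjugate.
degreesOfValues-⇔ : ∀ {Q Q′} → ProperlyEquivalent Q Q′ →
                    ∀ d → d ∈ DegreesOfValues Q ⇔ d ∈ DegreesOfValues Q′
degreesOfValues-⇔ {Q} {Q′} (mat α′ β′ γ′ δ′ , det≈1 , a′≈ , b′≈ , c′≈) d = mk⇔ to from
  where
  α = series α′ ; β = series β′ ; γ = series γ′ ; δ = series δ′
  value : ∀ X Y → Q′ ⟨ X , Y ⟩ ≈ Q ⟨ α * X + β * Y , γ * X + δ * Y ⟩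
  value X Y = transform-value (a Q) (b Q) (c Q) {a Q′} {b Q′} {c Q′} α β γ δ X Y a′≈ b′≈ c′≈
  to : d ∈ DegreesOfValues Q → d ∈ DegreesOfValues Q′
  to (X , Y , ≉0 , h) = U , V
    , (λ (U≈0 , V≈0) → ≉0
        ( ≈-trans {series X} {α * u + β * v} {0#} (≈-sym {α * u + β * v} {series X} x≈)
            (combination≈0 α β {u} {v} U≈0 V≈0)
        , ≈-trans {series Y} {γ * u + δ * v} {0#} (≈-sym {γ * u + δ * v} {series Y} y≈)
            (combination≈0 γ δ {u} {v} U≈0 V≈0)))
    , hasDegree-cong {Q ⟨ series X , series Y ⟩} {Q′ ⟨ u , v ⟩}
        (≈-sym {Q′ ⟨ u , v ⟩} {Q ⟨ series X , series Y ⟩}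
          (≈-trans {Q′ ⟨ u , v ⟩} {Q ⟨ α * u + β * v , γ * u + δ * v ⟩} {Q ⟨ series X , series Y ⟩}
            (value u v)
            (⟪⟫-cong {a Q} {b Q} {c Q} {a Q} {b Q} {c Q} {α * u + β * v} {γ * u + δ * v} {series X} {series Y}
              (≈-refl {a Q}) (≈-refl {b Q}) (≈-refl {c Q}) x≈ y≈)))
        h
    where
    U = δ′ *ₚ X -ₚ β′ *ₚ Y
    V = α′ *ₚ Y -ₚ γ′ *ₚ X
    u = series U
    v = series V
    x≈ : α * u + β * v ≈ series X
    x≈ = solve-X {α} {β} {γ} {δ} det≈1 (series X) (series Y)
    y≈ : γ * u + δ * v ≈ series Y
    y≈ = solve-Y {α} {β} {γ} {δ} det≈1 (series X) (series Y)
  from : d ∈ DegreesOfValues Q′ → d ∈ DegreesOfValues Q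
  from (X , Y , ≉0 , h) = α′ *ₚ X +ₚ β′ *ₚ Y , γ′ *ₚ X +ₚ δ′ *ₚ Y
    , (λ (U≈0 , V≈0) → ≉0 (image≈0⇒≈0 {α} {β} {γ} {δ} det≈1 {series X} {series Y} U≈0 V≈0))
    , hasDegree-cong {Q′ ⟨ series X , series Y ⟩}
        {Q ⟨ α * series X + β * series Y , γ * series X + δ * series Y ⟩}
        (value (series X) (series Y)) h

ℤ-induction : (P : ℤ → Set) → (∀ i → P i ⇔ P (ℤ.suc i)) → P 0ℤ → ∀ i → P i
ℤ-induction P step p0 (+ zero)        = p0
ℤ-induction P step p0 (+ suc n)       = Equivalence.to (step (+ n)) (ℤ-induction P step p0 (+ n))
ℤ-induction P step p0 -[1+ zero ]     = Equivalence.from (step -[1+ 0 ]) p0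
ℤ-induction P step p0 -[1+ suc n ]    =
  Equivalence.from (step -[1+ suc n ]) (ℤ-induction P step p0 -[1+ n ])

suc-neg-suc : ∀ n → ℤ.suc (ℤ.- (+ suc n)) ≡ ℤ.- (+ n)
suc-neg-suc zero    = refl
suc-neg-suc (suc n) = refl

-- Both halves of `IsInfimum` mention S only through its lower bounds, so no infimum has to be
-- constructed.
isInfimum-cong : ∀ {S S′ : Pred (ℤ ₋) 0ℓ} →
  (∀ l → IsLowerBound S l ⇔ IsLowerBound S′ l) → ∀ m → IsInfimum S m ⇔ IsInfimum S′ m
isInfimum-cong bounds m = mk⇔
  (λ (lb , greatest) → to (bounds m) lb , λ l l-lb → greatest l (from (bounds l) l-lb))
  (λ (lb , greatest) → from (bounds m) lb , λ l l-lb → greatest l (to (bounds l) l-lb))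
  where open Equivalence

-- `Reduced` provides degrees for the roots but only nonvanishing for a. So the leading term of a,
-- and with it those of r and b, comes under a double negation.
lead-of-reduced : ∀ {r} Q → Reduced r Q →
  ¬ ¬ (∃[ α ] ∃[ a₀ ] ∃[ ρ ] ∃[ r₀ ] a₀ ≢ 0ℚ × Lead (a Q) α a₀ ×
       r₀ ≢ 0ℚ × α ℤ.< ρ × Lead r ρ r₀ × Lead (b Q) ρ r₀)
lead-of-reduced {r} Q reduced none = ¬¬zero-or-lead (a Q) λ where
    (inj₁ a≈0)                   → a≉0 a≈0
    (inj₂ (α , a₀ , a₀≢0 , la)) →
      none (α , a₀ , with-roots a₀≢0 la (f-small hasDegree-f deg-f<0) hasDegree-s 0<deg-s)
  where
  open Reduced reduced
  f-small : ∀ {d} → HasDegree f d → d <₋ [ 0ℤ ] → Lead f 0ℤ 0ℚ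
  f-small (isZero f≈0)      _       = ⊥-elim (f≉0 f≈0)
  f-small (leading _ above) [ n<0 ] = lead-< {f} (refl , above) n<0
  with-roots : ∀ {α a₀ d} → a₀ ≢ 0ℚ → Lead (a Q) α a₀ → Lead f 0ℤ 0ℚ →
    HasDegree s d → [ 0ℤ ] <₋ d →
    ∃[ ρ ] ∃[ r₀ ] a₀ ≢ 0ℚ × Lead (a Q) α a₀ ×
      r₀ ≢ 0ℚ × α ℤ.< ρ × Lead r ρ r₀ × Lead (b Q) ρ r₀
  with-roots a₀≢0 la lf (leading s₀≢0 above) [ 0<σ ] =
    let ρ , r₀ , r₀≢0 , α<ρ , lr , lb =
          reduced-lead {r} {a Q} {b Q} {f} {s} (proj₂ isFirstRoot) (proj₂ isSecondRoot)
            a₀≢0 la lf s₀≢0 (refl , above) 0<σ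
    in ρ , r₀ , a₀≢0 , la , r₀≢0 , α<ρ , lr , lb

-- Chains of reduced forms

module Chain
  (r : ℚ⟨⟨1/T⟩⟩) (Φ : ℤ → BinaryQuadraticForm)
  (reduced : ∀ i → Reduced r (Φ i))
  (A B : ℤ → ℚ⟨⟨1/T⟩⟩)
  (coefficients : ∀ i → HasCoefficients (Φ i) (-1^ i * A i) (B i) (-1^ (ℤ.suc i) * A (ℤ.suc i)))
  (δ : ℤ → ℚ[T])
  (transforms : ∀ i → Transforms (mat 0ₚ 1ₚ -1ₚ (δ i)) (Φ i) (Φ (ℤ.suc i)))
  where

  degree-A⇔degree-a : ∀ i d → HasDegree (A i) d ⇔ HasDegree (a (Φ i)) d
  degree-A⇔degree-a i d = mk⇔
    (hasDegree-cong { -1^ i * A i} {a (Φ i)} (≈-sym {a (Φ i)} { -1^ i * A i} a≈) ∘ from (hasDegree-sign i (A i)))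
    (to (hasDegree-sign i (A i)) ∘ hasDegree-cong {a (Φ i)} { -1^ i * A i} a≈)
    where
    open Equivalence
    a≈ = proj₁ (coefficients i)

  c≈next-a : ∀ i → c (Φ i) ≈ a (Φ (ℤ.suc i))
  c≈next-a i n = trans (proj₂ (proj₂ (coefficients i)) n) (sym (proj₁ (coefficients (ℤ.suc i)) n))

  degrees-⇔ : ∀ i d → d ∈ DegreesOfValues (Φ 0ℤ) ⇔ d ∈ DegreesOfValues (Φ i)
  degrees-⇔ i d = mk⇔
    (ℤ-induction (λ i → d ∈ DegreesOfValues (Φ 0ℤ) → d ∈ DegreesOfValues (Φ i))
      (λ i → mk⇔ (to (step i) ∘_) (from (step i) ∘_)) (λ d∈ → d∈) i)
    (ℤ-induction (λ i → d ∈ DegreesOfValues (Φ i) → d ∈ DegreesOfValues (Φ 0ℤ))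
      (λ i → mk⇔ (_∘ from (step i)) (_∘ to (step i))) (λ d∈ → d∈) i)
    where
    open Equivalence
    step : ∀ i → d ∈ DegreesOfValues (Φ i) ⇔ d ∈ DegreesOfValues (Φ (ℤ.suc i))
    step i = degreesOfValues-⇔ {Φ i} {Φ (ℤ.suc i)}
      (mat 0ₚ 1ₚ -1ₚ (δ i) , det-step (series (δ i)) , transforms i) d

  -- Up to sign, A i is the value of `Φ i` at (1 , 0), and equivalent forms share the degrees of
  -- their values.
  family⊆values : ∀ d → d ∈ DegreesOfFamily A → d ∈ DegreesOfValues (Φ 0ℤ)
  family⊆values d (i , h) = Equivalence.from (degrees-⇔ i d) (1ₚ , 0ₚ ,
    (λ (1≈0 , _) → ℚₚ.1≢0 (1≈0 0ℤ)) ,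
    hasDegree-cong {a (Φ i)} {Φ i ⟨ 1# , 0# ⟩}
      (≈-sym {Φ i ⟨ 1# , 0# ⟩} {a (Φ i)} (value-at-⟨1,0⟩ (a (Φ i)) (b (Φ i)) (c (Φ i))))
      (Equivalence.to (degree-A⇔degree-a i d) h))

  forms-step : ∀ i → Step (a (Φ i)) (b (Φ i)) (c (Φ i)) (series (δ i))
    (a (Φ (ℤ.suc i))) (b (Φ (ℤ.suc i))) (c (Φ (ℤ.suc i)))
  forms-step i =
    let a′≈ , b′≈ , c′≈ = transforms i
    in transform⇒step {a (Φ i)} {b (Φ i)} {c (Φ i)} {series (δ i)}
         {a (Φ (ℤ.suc i))} {b (Φ (ℤ.suc i))} {c (Φ (ℤ.suc i))} a′≈ b′≈ c′≈

  module _ {L ρ r₀} (r₀≢0 : r₀ ≢ 0ℚ) (r-lead : Lead r ρ r₀)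
           (L-bound : IsLowerBound (DegreesOfFamily A) [ L ]) where

    Bounded : ℚ⟨⟨1/T⟩⟩ → Set
    Bounded x = ∃[ γ ] ∃[ c₀ ] c₀ ≢ 0ℚ × Lead x γ c₀ × L ℤ.≤ γ × γ ℤ.< ρ

    -- Each form yields a leading term of the same root r. By uniqueness these all agree with (ρ ,
    -- r₀), hence so do the leading terms of all b.
    leading-terms : ∀ i → ¬ ¬ (Bounded (a (Φ i)) × Lead (b (Φ i)) ρ r₀)
    leading-terms i none = lead-of-reduced (Φ i) (reduced i)
      λ (α , a₀ , ρ′ , r₀′ , a₀≢0 , la , r₀′≢0 , α<ρ′ , lr , lb) →
        let ρ′≡ρ   = degree-unique {r} r₀′≢0 lr r₀≢0 r-lead
            r₀′≡r₀ = lead-unique {r} (subst (λ n → Lead r n r₀′) ρ′≡ρ lr) r-lead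
        in none
          ( (α , a₀ , a₀≢0 , la , L≤ a₀≢0 la , subst (α ℤ.<_) ρ′≡ρ α<ρ′)
          , subst (Lead (b (Φ i)) ρ) r₀′≡r₀ (subst (λ n → Lead (b (Φ i)) n r₀′) ρ′≡ρ lb))
      where
      L≤ : ∀ {α a₀} → a₀ ≢ 0ℚ → Lead (a (Φ i)) α a₀ → L ℤ.≤ α
      L≤ {α} a₀≢0 la with L-bound [ α ]
        (i , Equivalence.from (degree-A⇔degree-a i [ α ]) (lead⇒hasDegree {a (Φ i)} a₀≢0 la))
      ... | [ L≤α ] = L≤α

    bounded⇒admissible : ∀ {x y z} → Bounded x → Lead y ρ r₀ → Bounded z → Admissible L ρ r₀ x y z
    bounded⇒admissible {x} (α , _ , _ , lx , _ , α<ρ) ly (γ , c₀ , c₀≢0 , lz , L≤γ , γ<ρ) = record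
      { a-small = lead-< {x} lx α<ρ
      ; b-lead  = ly
      ; γ       = γ
      ; c₀      = c₀
      ; c₀≢0    = c₀≢0
      ; c-lead  = lz
      ; L≤γ     = L≤γ
      ; γ<ρ     = γ<ρ
      }

    c-bounded : ∀ i → Bounded (a (Φ (ℤ.suc i))) → Bounded (c (Φ i))
    c-bounded i (γ , c₀ , c₀≢0 , la , bounds) = γ , c₀ , c₀≢0 ,
      lead-cong {a (Φ (ℤ.suc i))} {c (Φ i)} (≈-sym {c (Φ i)} {a (Φ (ℤ.suc i))} (c≈next-a i)) la , bounds

    -- The bounds for c are those for a in the next form.
    admissible : ∀ i → ¬ ¬ Admissible L ρ r₀ (a (Φ i)) (b (Φ i)) (c (Φ i))
    admissible i none = leading-terms i λ (ba , lb) → leading-terms (ℤ.suc i) λ (ba′ , _) →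
      none (bounded⇒admissible {a (Φ i)} {b (Φ i)} {c (Φ i)} ba lb (c-bounded i ba′))

    admissible-swapped : ∀ i → ¬ ¬ Admissible L ρ r₀ (c (Φ i)) (b (Φ i)) (a (Φ i))
    admissible-swapped i none = leading-terms i λ (ba , lb) → leading-terms (ℤ.suc i) λ (ba′ , _) →
      none (bounded⇒admissible {c (Φ i)} {b (Φ i)} {a (Φ i)} (c-bounded i ba′) lb ba)

    ∣y∣-bound : ∀ y → y ℤ.< + suc ∣ y ∣
    ∣y∣-bound (+ n)    = ℤₚ.suc[i]≤j⇒i<j ℤₚ.≤-refl
    ∣y∣-bound -[1+ n ] = ℤ.-<+

    module _ {X Y : ℚ[T]} (v-small : Lead (Φ 0ℤ ⟨ series X , series Y ⟩) L 0ℚ) where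
      private
        x′ = series X
        y′ = series Y
        v  = Φ 0ℤ ⟨ x′ , y′ ⟩

      forward : ∀ {y y₀} → y₀ ≢ 0ℚ → Lead y′ y y₀ →
        (∀ {x x₀} → x₀ ≢ 0ℚ → Lead x′ x x₀ → x ℤ.≤ y) → ⊥
      forward {y} y₀≢0 lY x≤y = descend r₀≢0
        (λ n → a (Φ (+ n))) (λ n → b (Φ (+ n))) (λ n → c (Φ (+ n))) (λ n → series (δ (+ n)))
        (λ n → forms-step (+ n)) (λ n → admissible (+ n)) (λ n → polynomial (δ (+ n)))
        {v} v-small (suc ∣ y ∣) 0 {x′} {y′} (polynomial X) (polynomial Y)
        y₀≢0 lY x≤y (∣y∣-bound y) (≈-refl {v})

      -- With the variables exchanged, a takes the place of c, and `reverse` makes each move from a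
      -- form to its predecessor a step of the descent.
      backward : ∀ {x x₀} → x₀ ≢ 0ℚ → Lead x′ x x₀ →
        (∀ {y y₀} → y₀ ≢ 0ℚ → Lead y′ y y₀ → y ℤ.≤ x) → ⊥
      backward {x} x₀≢0 lX y≤x = descend r₀≢0
        (λ n → c (Φ (ℤ.- + n))) (λ n → b (Φ (ℤ.- + n))) (λ n → a (Φ (ℤ.- + n)))
        -- Passing from index - n to index - n - 1 undoes the step that starts at - n - 1, whence
        -- the shift.
        (λ n → series (δ -[1+ n ]))
        step (λ n → admissible-swapped (ℤ.- + n)) (λ n → polynomial (δ -[1+ n ]))
        {v} v-small (suc ∣ x ∣) 0 {y′} {x′} (polynomial Y) (polynomial X)
        x₀≢0 lX y≤x (∣y∣-bound x) (swap-value (a (Φ 0ℤ)) (b (Φ 0ℤ)) (c (Φ 0ℤ)) x′ y′)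
        where
        step : ∀ n → Step (c (Φ (ℤ.- + n))) (b (Φ (ℤ.- + n))) (a (Φ (ℤ.- + n))) (series (δ -[1+ n ]))
          (c (Φ -[1+ n ])) (b (Φ -[1+ n ])) (a (Φ -[1+ n ]))
        step n = subst
          (λ i → Step (c (Φ i)) (b (Φ i)) (a (Φ i)) (series (δ -[1+ n ]))
            (c (Φ -[1+ n ])) (b (Φ -[1+ n ])) (a (Φ -[1+ n ])))
          (suc-neg-suc n) (reverse (forms-step -[1+ n ]))

      -- The variable of larger degree plays the role of Y in the descent; a vanishing one meets the
      -- degree condition vacuously.
      not-small : ¬ (x′ ≈ 0# × y′ ≈ 0#) → ⊥
      not-small ≉0 = ¬¬zero-or-lead x′ λ X-cases → ¬¬zero-or-lead y′ λ Y-cases → cases X-cases Y-cases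
        where
        cases : x′ ≈ 0# ⊎ (∃[ n ] ∃[ k ] k ≢ 0ℚ × Lead x′ n k) →
                y′ ≈ 0# ⊎ (∃[ n ] ∃[ k ] k ≢ 0ℚ × Lead y′ n k) → ⊥
        cases (inj₁ X≈0) (inj₁ Y≈0) = ≉0 (X≈0 , Y≈0)
        cases (inj₁ X≈0) (inj₂ (y , y₀ , y₀≢0 , lY)) =
          forward y₀≢0 lY λ x₀≢0 lX → ⊥-elim (≈0⇒¬lead {x′} X≈0 x₀≢0 lX)
        cases (inj₂ (x , x₀ , x₀≢0 , lX)) (inj₁ Y≈0) =
          backward x₀≢0 lX λ y₀≢0 lY → ⊥-elim (≈0⇒¬lead {y′} Y≈0 y₀≢0 lY)
        cases (inj₂ (x , x₀ , x₀≢0 , lX)) (inj₂ (y , y₀ , y₀≢0 , lY)) with ℤₚ.≤-total x y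
        ... | inj₁ x≤y = forward y₀≢0 lY λ z₀≢0 lZ →
          ℤₚ.≤-trans (ℤₚ.≤-reflexive (degree-unique {x′} z₀≢0 lZ x₀≢0 lX)) x≤y
        ... | inj₂ y≤x = backward x₀≢0 lX λ z₀≢0 lZ →
          ℤₚ.≤-trans (ℤₚ.≤-reflexive (degree-unique {y′} z₀≢0 lZ y₀≢0 lY)) y≤x

  -- The descent only refutes deg v < L. That is enough, since the degree of v is given and its
  -- comparison with L is decidable.
  family-bound⇒values-bound : ∀ l → IsLowerBound (DegreesOfFamily A) l →
                              IsLowerBound (DegreesOfValues (Φ 0ℤ)) l
  family-bound⇒values-bound ⊥₋    _       d _ = ⊥₋≤ d
  family-bound⇒values-bound [ L ] L-bound d (X , Y , ≉0 , h) = compare d h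
    where
    v = Φ 0ℤ ⟨ series X , series Y ⟩
    v-not-small : ¬ Lead v L 0ℚ
    v-not-small v-small = lead-of-reduced (Φ 0ℤ) (reduced 0ℤ)
      λ (_ , _ , ρ , r₀ , _ , _ , r₀≢0 , _ , lr , _) →
        not-small r₀≢0 lr L-bound {X} {Y} v-small ≉0
    compare : ∀ d → HasDegree v d → [ L ] ≤₋ d
    -- A value 0 also lies below L, so the same descent excludes it.
    compare _ (isZero v≈0) = ⊥-elim (v-not-small
      ( trans (v≈0 L) (coeff-0# L) , λ m _ → trans (v≈0 m) (coeff-0# m)))
    compare [ n ] h@(leading _ above) with L ℤₚ.≤? n
    ... | yes L≤n = [ L≤n ]
    ... | no  L≰n = ⊥-elim (v-not-small (lead-< {v} (refl , above) (ℤₚ.≰⇒> L≰n)))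

theorem8 : (D √D : ℚ⟨⟨1/T⟩⟩) → √D * √D ≈ D →
    (Φ : ℤ → BinaryQuadraticForm) →
    (∀ i → disc (Φ i) ≈ D) →
    (∀ i → Indefinite (Φ i)) →
    (∀ i → Reduced √D (Φ i)) →
    (A B : ℤ → ℚ⟨⟨1/T⟩⟩) →
    (∀ i → HasCoefficients (Φ i) (-1^ i * A i) (B i) (-1^ (ℤ.suc i) * A (ℤ.suc i))) →
    (δ : ℤ → ℚ[T]) →
    (∀ i → Transforms (mat 0ₚ 1ₚ -1ₚ (δ i)) (Φ i) (Φ (ℤ.suc i))) →
    (Q : BinaryQuadraticForm) → ProperlyEquivalent Q (Φ 0ℤ) →
    ∀ m → IsMinimum Q m ⇔ IsInfimum (DegreesOfFamily A) m
theorem8 D √D _ Φ _ _ reduced A B coefficients δ transforms Q Q∼Φ₀ =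
  isInfimum-cong λ l → mk⇔
    (λ l-lb d d∈A → l-lb d (from (equiv d) (family⊆values d d∈A)))
    (λ l-lb d d∈Q → family-bound⇒values-bound l l-lb d (to (equiv d) d∈Q))
  where
  open Equivalence
  open Chain √D Φ reduced A B coefficients δ transforms
  equiv : ∀ d → d ∈ DegreesOfValues Q ⇔ d ∈ DegreesOfValues (Φ 0ℤ)
  equiv = degreesOfValues-⇔ {Q} {Φ 0ℤ} Q∼Φ₀
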